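{- Let $G=(V,E)$ be a loopless graph (multiple edges allowed), viewed as a hypergraph in which every hyperedge has two elements, and fix a ribbon structure, base node and base edge on $\mathrm{Bip}\,G$. Let $T$ be a $V$-cut Jaeger tree of $\mathrm{Bip}\,G$. Then the number of internally inactive elements of $E$ for the hypertree $\mathbf f_E(T)$, with respect to the violet $T$-order on $E$, equals the number of internally inactive elements of $V$ for the hypertree $\mathbf f_V(T)$, with respect to the violet $T$-order on $V$.
   Context: $\mathrm{Bip}\,G$ is the bipartite graph with color classes $V$ (violet) and $E$ (emerald), each $e\in E$ joined to its two endpoints (i.e., $G$ with each edge subdivided). A ribbon structure assigns to each node $x$ a cyclic permutation of its incident edges; $xy^+$ is the edge following $xy$ at $x$. Base node $b_0$, incident base edge $b_0b_1$. Tour of a spanning tree $T$ of $\mathrm{Bip}\,G$: pairs (current node, current edge) starting with $(b_0,b_0b_1)$; from $(x,xy)$ go to $(x,xy^+)$ if $xy\notin T$, to $(y,yx^+)$ if $xy\in T$; stop right before $(b_0,b_0b_1)$ recurs. Each edge $xy$ appears exactly twice; a non-edge $xy$ is cut at $x$ if $(x,xy)$ comes first. $T$ is a $V$-cut Jaeger tree if every non-edge of $T$ is cut at its violet endpoint. Violet $T$-order on edges: $ev<_{T,V}e'v'$ ($v,v'\in V$) iff $(v,ev)$ precedes $(v',e'v')$ in the tour. Violet $T$-order on $E$ (resp. $V$): $x_1<x_2$ iff some edge incident to $x_1$ precedes in the violet $T$-order every edge incident to $x_2$. A hypertree on $E$ is $\mathbf f:E\to\mathbb Z_{\ge0}$ such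 that some spanning tree of $\mathrm{Bip}\,G$ has degree $\mathbf f(e)+1$ at each $e\in E$; similarly on $V$; $\mathbf f_E(T)(e)=d_T(e)-1$, $\mathbf f_V(T)(v)=d_T(v)-1$. Given a linear order on $X\in\{E,V\}$ and a hypertree $\mathbf f$ on $X$, $x\in X$ is internally inactive if there is $x'<x$ such that decreasing $\mathbf f$ by $1$ at $x$ and increasing by $1$ at $x'$ yields a hypertree on $X$. -}

module Defs where

open import Data.Nat using (ℕ; zero; suc; _+_; _∸_; _≤_)
open import Data.Fin using (Fin; _≟_)
open import Data.Bool using (Bool; true; false; not; if_then_else_; _∧_)
open import Data.Product using (Σ; ∃; _×_; _,_; proj₁; proj₂; ∃-syntax)
open import Data.Sum using (_⊎_; inj₁; inj₂)
open import Relation.Binary.PropositionalEquality using (_≡_; _≢_)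
open import Relation.Nullary.Decidable using (⌊_⌋)
open import Function.Bundles using (_⇔_)
open import Data.Fin.Subset using (Subset; _∈_; ∣_∣)

iter : {A : Set} → ℕ → (A → A) → A → A
iter zero    f a = a
iter (suc k) f a = f (iter k f a)

⟦_⟧ : Bool → ℕ
⟦ true ⟧  = 1
⟦ false ⟧ = 0

ΣF : (k : ℕ) → (Fin k → ℕ) → ℕ
ΣF zero    g = 0
ΣF (suc k) g = g Fin.zero + ΣF k (λ i → g (Fin.suc i))

-- Graph and Bip G ----------------------------------------------------------
-- A (multi)graph G = (V,E) with V = Fin n, E = Fin m is given by
-- end : Fin m → Bool → Fin n, the two endpoints of each edge.
-- Bip G has node set V ⊎ E (inj₁ = violet, inj₂ = emerald); its edges are
-- the pairs (e , s) : Fin m × Bool, joining emerald e to violet  end e s.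

module Bip {n m : ℕ} (end : Fin m → Bool → Fin n) where

  Loopless : Set
  Loopless = ∀ e → end e false ≢ end e true

  Node : Set
  Node = Fin n ⊎ Fin m

  BEdge : Set
  BEdge = Fin m × Bool

  vert : BEdge → Fin n
  vert (e , s) = end e s

  emer : BEdge → Fin m
  emer (e , s) = e

  -- the other Bip-edge at the same emerald node (the unique cyclic
  -- permutation of the two edges incident to an emerald node)
  flipE : BEdge → BEdge
  flipE (e , s) = (e , not s)

  record Ribbon : Set where
    field
      σ     : BEdge → BEdge
      σ-vert : ∀ b → vert (σ b) ≡ vert b
      σ-inj  : ∀ b b' → σ b ≡ σ b' → b ≡ b'
      σ-cyc  : ∀ b b' → vert b ≡ vert b' → ∃[ k ] iter k σ b ≡ b'

  -- Subgraphs of Bip G (spanning, given by their edge set)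
  Sub : Set
  Sub = BEdge → Bool

  Link : Sub → BEdge → Node → Node → Set
  Link T b x y = T b ≡ true ×
    ((x ≡ inj₁ (vert b) × y ≡ inj₂ (emer b)) ⊎ (x ≡ inj₂ (emer b) × y ≡ inj₁ (vert b)))

  data Reach (T : Sub) (x : Node) : Node → Set where
    here : Reach T x x
    there : ∀ {y z} b → Reach T x y → Link T b y z → Reach T x z

  Connected : Sub → Set
  Connected T = ∀ x y → Reach T x y

  degE : Sub → Fin m → ℕ
  degE T e = ⟦ T (e , false) ⟧ + ⟦ T (e , true) ⟧

  degV : Sub → Fin n → ℕ
  degV T v = ΣF m (λ e → ⟦ T (e , false) ∧ ⌊ end e false ≟ v ⌋ ⟧
                       + ⟦ T (e , true)  ∧ ⌊ end e true  ≟ v ⌋ ⟧)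

  numEdges : Sub → ℕ
  numEdges T = ΣF m (degE T)

  IsSpanningTree : Sub → Set
  IsSpanningTree T = Connected T × numEdges T + 1 ≡ n + m

  IsHypertreeE : (Fin m → ℕ) → Set
  IsHypertreeE f = ∃[ T ] IsSpanningTree T × (∀ e → degE T e ≡ suc (f e))

  IsHypertreeV : (Fin n → ℕ) → Set
  IsHypertreeV f = ∃[ T ] IsSpanningTree T × (∀ v → degV T v ≡ suc (f v))

  fE : Sub → Fin m → ℕ
  fE T e = degE T e ∸ 1

  fV : Sub → Fin n → ℕ
  fV T v = degV T v ∸ 1

  -- Tour ------------------------------------------------------------------
  -- A state (current node, current edge) is a Bip-edge b together with a
  -- flag: true = current node is the violet endpoint of b,
  --       false = current node is the emerald endpoint of b.
  State : Set
  State = BEdge × Bool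

  step : Ribbon → Sub → State → State
  step ρ T (b , true)  = if T b then (flipE b , false) else (Ribbon.σ ρ b , true)
  step ρ T (b , false) = if T b then (Ribbon.σ ρ b , true) else (flipE b , false)

  -- k-th state of the tour; `start` is (b₀ , b₀b₁)
  tour : Ribbon → State → Sub → ℕ → State
  tour ρ start T k = iter k (step ρ T) start

  Occurs : Ribbon → State → Sub → State → Set
  Occurs ρ start T s = ∃[ k ] tour ρ start T k ≡ s

  Precedes : Ribbon → State → Sub → State → State → Set
  Precedes ρ start T s s' =
    (∃[ k ] tour ρ start T k ≡ s × (∀ j → j ≤ k → tour ρ start T j ≢ s'))
    × Occurs ρ start T s'

  IsVCutJaeger : Ribbon → State → Sub → Set
  IsVCutJaeger ρ start T =
    ∀ b → T b ≡ false → Precedes ρ start T (b , true) (b , false)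

  _<ᵇ[_,_,_]_ : BEdge → Ribbon → State → Sub → BEdge → Set
  b <ᵇ[ ρ , start , T ] b' = Precedes ρ start T (b , true) (b' , true)

  VioletOrderE : Ribbon → State → Sub → Fin m → Fin m → Set
  VioletOrderE ρ start T e₁ e₂ =
    ∃[ s ] (∀ s' → (e₁ , s) <ᵇ[ ρ , start , T ] (e₂ , s'))

  VioletOrderV : Ribbon → State → Sub → Fin n → Fin n → Set
  VioletOrderV ρ start T v₁ v₂ =
    ∃[ b ] vert b ≡ v₁ × (∀ b' → vert b' ≡ v₂ → b <ᵇ[ ρ , start , T ] b')

transfer : {k : ℕ} → (Fin k → ℕ) → Fin k → Fin k → Fin k → ℕ
transfer f x x' y =
  if ⌊ y ≟ x ⌋ then f y ∸ 1 else (if ⌊ y ≟ x' ⌋ then suc (f y) else f y)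

InternallyInactive : {k : ℕ} → ((Fin k → ℕ) → Set) → (Fin k → Fin k → Set)
                   → (Fin k → ℕ) → Fin k → Set
InternallyInactive IsHT _≺_ f x =
  ∃[ x' ] x' ≺ x × 1 ≤ f x × IsHT (transfer f x x')

NumberIs : {N : ℕ} → (Fin N → Set) → ℕ → Set
NumberIs {N} P k = Σ (Subset N) λ A → (∀ x → (x ∈ A) ⇔ P x) × ∣ A ∣ ≡ k

{-# OPTIONS --safe #-}
module Submission where

-- Let F be the set of e ∈ E of degree 2 in T.  Every e ∈ F has a child half-edge b, joining e to the
-- endpoint toured later, and e ↦ vert b is a bijection from F onto the violet nodes other than the
-- first one toured.  Removing b from T splits the nodes into a false side (containing e and the base)
-- and a true side (containing vert b), and the states of the true side form one interval of the tour.
-- For e, and equally for vert b, internal inactivity means that some b′ of Bip G joins an emerald node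
-- of the true side to a violet node of the false side.  Given b′, the tree T − b + b′ realizes both
-- transfers, and since b′ is cut at its violet end it comes before b.  Conversely, a transfer at e
-- supplies such a b′ because F − e + e′ must join the two sides, and a transfer at vert b supplies one
-- because otherwise the degree sum over the true violet nodes is already minimal for T.

open import Defs
open import Data.Nat using (ℕ; zero; suc; _+_; _∸_; _*_; _≤_; _<_; z≤n; s≤s; s≤s⁻¹)
import Data.Nat.Properties as ℕ
open import Algebra.Properties.CommutativeSemigroup ℕ.+-commutativeSemigroup using (interchange)
open import Data.Fin using (Fin; zero; suc; _≟_; toℕ; combine)
import Data.Fin.Properties as Fin
open import Data.Bool using (Bool; true; false; not; if_then_else_; _∧_; _∨_)
import Data.Bool.Properties as Bool
open import Data.Product using (Σ; ∃; _×_; _,_; proj₁; proj₂; ∃-syntax; uncurry)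
open import Data.Product.Properties using (≡-dec)
open import Data.Sum using (_⊎_; inj₁; inj₂)
import Data.Sum.Properties as Sum
open import Data.Fin.Subset using (Subset; _∈_; ∣_∣; _-_)
open import Data.Fin.Subset.Properties using (x∈p∧x≢y⇒x∈p-y; x∈p⇒∣p-x∣<∣p∣)
open import Data.Vec using (_∷_; []; here; there; tabulate)
open import Data.Vec.Properties using (lookup∘tabulate; lookup⇒[]=; []=⇒lookup)
open import Axiom.UniquenessOfIdentityProofs using (module Decidable⇒UIP)
open import Relation.Binary.Definitions using (DecidableEquality; tri<; tri≈; tri>)
open import Relation.Binary.PropositionalEquality
open import Relation.Nullary using (¬_; Dec; yes; no; does; contradiction)
open import Relation.Nullary.Decidable using (⌊_⌋; dec-true; _×-dec_; _⊎-dec_; map′)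
open import Function using (_∘_; case_of_)
open import Function.Bundles using (_⇔_; mk⇔; Equivalence)

-- Finite sums and Boolean indicators

ΣF-cong : ∀ k {f g : Fin k → ℕ} → (∀ i → f i ≡ g i) → ΣF k f ≡ ΣF k g
ΣF-cong zero    f≗g = refl
ΣF-cong (suc k) f≗g = cong₂ _+_ (f≗g zero) (ΣF-cong k (f≗g ∘ suc))

ΣF-mono : ∀ k {f g : Fin k → ℕ} → (∀ i → f i ≤ g i) → ΣF k f ≤ ΣF k g
ΣF-mono zero    f≤g = z≤n
ΣF-mono (suc k) f≤g = ℕ.+-mono-≤ (f≤g zero) (ΣF-mono k (f≤g ∘ suc))

ΣF-zero : ∀ k {f : Fin k → ℕ} → (∀ i → f i ≡ 0) → ΣF k f ≡ 0
ΣF-zero zero    f≗0 = refl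
ΣF-zero (suc k) f≗0 = cong₂ _+_ (f≗0 zero) (ΣF-zero k (f≗0 ∘ suc))

ΣF-one : ∀ k {f : Fin k → ℕ} → (∀ i → f i ≡ 1) → ΣF k f ≡ k
ΣF-one zero    f≗1 = refl
ΣF-one (suc k) f≗1 = cong₂ _+_ (f≗1 zero) (ΣF-one k (f≗1 ∘ suc))

ΣF-+ : ∀ k (f g : Fin k → ℕ) → ΣF k (λ i → f i + g i) ≡ ΣF k f + ΣF k g
ΣF-+ zero    f g = refl
ΣF-+ (suc k) f g = trans (cong (f zero + g zero +_) (ΣF-+ k (f ∘ suc) (g ∘ suc)))
                         (interchange (f zero) (g zero) _ _)

ΣF-*ˡ : ∀ k (a : ℕ) (f : Fin k → ℕ) → a * ΣF k f ≡ ΣF k (λ i → a * f i)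
ΣF-*ˡ zero    a f = ℕ.*-zeroʳ a
ΣF-*ˡ (suc k) a f = trans (ℕ.*-distribˡ-+ a (f zero) _) (cong (a * f zero +_) (ΣF-*ˡ k a (f ∘ suc)))

ΣF-swap : ∀ j k (f : Fin j → Fin k → ℕ) →
          ΣF j (λ x → ΣF k (f x)) ≡ ΣF k (λ y → ΣF j (λ x → f x y))
ΣF-swap zero    k f = sym (ΣF-zero k (λ _ → refl))
ΣF-swap (suc j) k f = trans (cong (ΣF k (f zero) +_) (ΣF-swap j k (f ∘ suc)))
                            (sym (ΣF-+ k (f zero) _))

ΣF-single : ∀ k {f : Fin k → ℕ} (j : Fin k) → (∀ i → i ≢ j → f i ≡ 0) → ΣF k f ≡ f j
ΣF-single (suc k) {f} zero    f≗0 =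
  trans (cong (f zero +_) (ΣF-zero k (λ i → f≗0 (suc i) λ ()))) (ℕ.+-identityʳ _)
ΣF-single (suc k) {f} (suc j) f≗0 =
  trans (cong (_+ ΣF k (f ∘ suc)) (f≗0 zero λ ()))
        (ΣF-single k j (λ i i≢j → f≗0 (suc i) (i≢j ∘ Fin.suc-injective)))

⌊⌋-yes : ∀ {A : Set} (d : Dec A) → A → ⌊ d ⌋ ≡ true
⌊⌋-yes (yes _) a = refl
⌊⌋-yes (no ¬a) a = contradiction a ¬a

⌊⌋-no : ∀ {A : Set} (d : Dec A) → ¬ A → ⌊ d ⌋ ≡ false
⌊⌋-no (yes a) ¬a = contradiction a ¬a
⌊⌋-no (no _)  ¬a = refl

not-true : ∀ {x} → x ≢ true → x ≡ false
not-true = Bool.¬-not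

⟦⟧≤1 : ∀ x → ⟦ x ⟧ ≤ 1
⟦⟧≤1 true  = s≤s z≤n
⟦⟧≤1 false = z≤n

-- Counting subsets through injections

-- Induction on `A`: each element uses up its image, which is removed from `B` before the remaining
-- elements are counted.
∣∣-injection : ∀ {j k} (A : Subset j) (B : Subset k) (f : ∀ x → x ∈ A → Fin k) →
               (∀ x (p : x ∈ A) → f x p ∈ B) →
               (∀ x y (p : x ∈ A) (q : y ∈ A) → f x p ≡ f y q → x ≡ y) → ∣ A ∣ ≤ ∣ B ∣
∣∣-injection []          B f f∈B inj = z≤n
∣∣-injection (false ∷ A) B f f∈B inj =
  ∣∣-injection A B (λ x p → f (suc x) (there p)) (λ x p → f∈B (suc x) (there p))
    (λ x y p q eq → Fin.suc-injective (inj _ _ (there p) (there q) eq))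
∣∣-injection (true ∷ A)  B f f∈B inj =
  ℕ.≤-<-trans
    (∣∣-injection A (B - f zero here) (λ x p → f (suc x) (there p))
      (λ x p → x∈p∧x≢y⇒x∈p-y (f∈B (suc x) (there p))
                 (λ eq → case inj _ _ (there p) here eq of λ ()))
      (λ x y p q eq → Fin.suc-injective (inj _ _ (there p) (there q) eq)))
    (x∈p⇒∣p-x∣<∣p∣ (f∈B zero here))

decSubset : ∀ {k} {P : Fin k → Set} → (∀ x → Dec (P x)) → ∃[ A ] (∀ x → (x ∈ A) ⇔ P x)
decSubset P? = tabulate (does ∘ P?) , λ x → mk⇔
  (λ x∈A → from-does (P? x) (trans (sym (lookup∘tabulate _ x)) ([]=⇒lookup x∈A)))
  (λ p → lookup⇒[]= x _ (trans (lookup∘tabulate _ x) (dec-true (P? x) p)))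
  where
  from-does : ∀ {A : Set} (d : Dec A) → does d ≡ true → A
  from-does (yes a) _ = a

-- `P` and `Q` are not assumed decidable; they become so by a finite search for an `R`-partner,
-- which yields the two subsets. Partners then give injections in both directions.
NumberIs-correspondence :
  ∀ {j k} {P : Fin j → Set} {Q : Fin k → Set} {R : Fin j → Fin k → Set} →
  (∀ x y → Dec (R x y)) →
  (∀ x → P x ⇔ (∃[ y ] R x y)) → (∀ y → Q y ⇔ (∃[ x ] R x y)) →
  (∀ {x y y'} → R x y → R x y' → y ≡ y') → (∀ {x x' y} → R x y → R x' y → x ≡ x') →
  ∃[ c ] NumberIs P c × NumberIs Q c
NumberIs-correspondence {P = P} {Q} {R} R? P⇔ Q⇔ functional injective =
  ∣ A ∣ , (A , A⇔ , refl) , (B , B⇔ , ℕ.≤-antisym B≤A A≤B)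
  where
  open Equivalence
  dec-P : ∀ x → Dec (P x)
  dec-P x = map′ (from (P⇔ x)) (to (P⇔ x)) (Fin.any? (R? x))
  dec-Q : ∀ y → Dec (Q y)
  dec-Q y = map′ (from (Q⇔ y)) (to (Q⇔ y)) (Fin.any? (λ x → R? x y))
  A  = proj₁ (decSubset dec-P)
  A⇔ = proj₂ (decSubset dec-P)
  B  = proj₁ (decSubset dec-Q)
  B⇔ = proj₂ (decSubset dec-Q)
  imgA : ∀ x → x ∈ A → ∃ (R x)
  imgA x p = to (P⇔ x) (to (A⇔ x) p)
  imgB : ∀ y → y ∈ B → ∃ λ x → R x y
  imgB y p = to (Q⇔ y) (to (B⇔ y) p)
  A≤B : ∣ A ∣ ≤ ∣ B ∣
  A≤B = ∣∣-injection A B (λ x p → proj₁ (imgA x p))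
    (λ x p → from (B⇔ _) (from (Q⇔ _) (x , proj₂ (imgA x p))))
    (λ x y p q eq → injective (subst (R x) eq (proj₂ (imgA x p))) (proj₂ (imgA y q)))
  B≤A : ∣ B ∣ ≤ ∣ A ∣
  B≤A = ∣∣-injection B A (λ y p → proj₁ (imgB y p))
    (λ y p → from (A⇔ _) (from (P⇔ _) (y , proj₂ (imgB y p))))
    (λ y z p q eq → functional (subst (λ x → R x y) eq (proj₂ (imgB y p))) (proj₂ (imgB z q)))

-- Least witnesses and iterated maps

least : {P : ℕ → Set} → (∀ k → Dec (P k)) → ∀ {k} → P k → ∃[ l ] P l × (∀ {j} → P j → l ≤ j)
least P? {k} p with P? zero
... | yes p₀ = zero , p₀ , λ _ → z≤n
least P? {zero}  p | no ¬p₀ = contradiction p ¬p₀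
least P? {suc k} p | no ¬p₀ with least (P? ∘ suc) p
... | l , pl , l≤ = suc l , pl , λ { {zero} p₀ → contradiction p₀ ¬p₀ ; {suc j} pj → s≤s (l≤ pj) }

module _ {A : Set} (f : A → A) where

  iter-suc : ∀ k a → iter k f (f a) ≡ f (iter k f a)
  iter-suc zero    a = refl
  iter-suc (suc k) a = cong f (iter-suc k a)

  iter-+ : ∀ j k a → iter (j + k) f a ≡ iter j f (iter k f a)
  iter-+ zero    k a = refl
  iter-+ (suc j) k a = cong f (iter-+ j k a)

  module _ (f-injective : ∀ {a b} → f a ≡ f b → a ≡ b) where

    iter-injective : ∀ k {a b} → iter k f a ≡ iter k f b → a ≡ b
    iter-injective zero    eq = eq
    iter-injective (suc k) eq = iter-injective k (f-injective eq)

    -- Two of the first `N + 1` iterates coincide by pigeonhole, and injectivity cancels the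
    -- iterations that they share.
    iter-recurrent : ∀ {N} (code : A → Fin N) → (∀ {a b} → code a ≡ code b → a ≡ b) →
                     ∀ a → ∃[ p ] iter (suc p) f a ≡ a
    iter-recurrent {N} code code-injective a
      with i , j , i<j , eq ← Fin.pigeonhole (ℕ.n<1+n N) (λ i → code (iter (toℕ i) f a))
      with p , i+1+p≡j ← ℕ.m≤n⇒∃[o]m+o≡n i<j
      = p , sym (iter-injective (toℕ i) (begin
        iter (toℕ i) f a                ≡⟨ code-injective eq ⟩
        iter (toℕ j) f a                ≡⟨ cong (λ k → iter k f a) i+1+p≡j ⟨
        iter (suc (toℕ i + p)) f a      ≡⟨ cong (λ k → iter k f a) (ℕ.+-suc (toℕ i) p) ⟨
        iter (toℕ i + suc p) f a        ≡⟨ iter-+ (toℕ i) (suc p) a ⟩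
        iter (toℕ i) f (iter (suc p) f a) ∎))
      where open ≡-Reasoning

-- Sums over the edges and nodes of `Bip G`

module Subdivision {n m : ℕ} (end : Fin m → Bool → Fin n) where
  open Bip end

  infix 4 _≟B_ _≟N_

  _≟B_ : DecidableEquality BEdge
  _≟B_ = ≡-dec _≟_ Bool._≟_

  _≟N_ : DecidableEquality Node
  _≟N_ = Sum.≡-dec _≟_ _≟_

  anyB? : {P : BEdge → Set} → (∀ b → Dec (P b)) → Dec (∃ P)
  anyB? P? = map′
    (λ { (e , inj₁ p) → (e , false) , p ; (e , inj₂ p) → (e , true) , p })
    (λ { ((e , false) , p) → e , inj₁ p ; ((e , true) , p) → e , inj₂ p })
    (Fin.any? (λ e → P? (e , false) ⊎-dec P? (e , true)))

  ΣB : (BEdge → ℕ) → ℕ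
  ΣB g = ΣF m (λ e → g (e , false) + g (e , true))

  ΣN : (Node → ℕ) → ℕ
  ΣN g = ΣF n (g ∘ inj₁) + ΣF m (g ∘ inj₂)

  ΣB-cong : ∀ {f g} → (∀ b → f b ≡ g b) → ΣB f ≡ ΣB g
  ΣB-cong f≗g = ΣF-cong m (λ e → cong₂ _+_ (f≗g _) (f≗g _))

  ΣB-mono : ∀ {f g} → (∀ b → f b ≤ g b) → ΣB f ≤ ΣB g
  ΣB-mono f≤g = ΣF-mono m (λ e → ℕ.+-mono-≤ (f≤g _) (f≤g _))

  ΣB-+ : ∀ f g → ΣB (λ b → f b + g b) ≡ ΣB f + ΣB g
  ΣB-+ f g = trans (ΣF-cong m (λ e → interchange (f (e , false)) (g (e , false)) _ _)) (ΣF-+ m _ _)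

  ΣB-single : ∀ {f} b → (∀ β → β ≢ b → f β ≡ 0) → ΣB f ≡ f b
  ΣB-single {f} (e , s) f≗0 = trans
    (ΣF-single m e (λ i i≢e → cong₂ _+_ (f≗0 _ (i≢e ∘ cong proj₁)) (f≗0 _ (i≢e ∘ cong proj₁))))
    (pair s f≗0)
    where
    pair : ∀ s → (∀ β → β ≢ (e , s) → f β ≡ 0) → f (e , false) + f (e , true) ≡ f (e , s)
    pair false f≗0 = trans (cong (f (e , false) +_) (f≗0 (e , true) λ ())) (ℕ.+-identityʳ _)
    pair true  f≗0 = cong (_+ f (e , true)) (f≗0 (e , false) λ ())

  ΣB-indicator : ∀ b → ΣB (λ β → ⟦ ⌊ β ≟B b ⌋ ⟧) ≡ 1
  ΣB-indicator b = trans (ΣB-single b (λ β β≢b → cong ⟦_⟧ (⌊⌋-no (β ≟B b) β≢b)))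
                         (cong ⟦_⟧ (⌊⌋-yes (b ≟B b) refl))

  ΣN-cong : ∀ {f g} → (∀ x → f x ≡ g x) → ΣN f ≡ ΣN g
  ΣN-cong f≗g = cong₂ _+_ (ΣF-cong n (λ v → f≗g _)) (ΣF-cong m (λ e → f≗g _))

  ΣN-+ : ∀ f g → ΣN (λ x → f x + g x) ≡ ΣN f + ΣN g
  ΣN-+ f g = trans (cong₂ _+_ (ΣF-+ n _ _) (ΣF-+ m _ _)) (interchange (ΣF n (f ∘ inj₁)) _ _ _)

  ΣN-single : ∀ {f} x → (∀ y → y ≢ x → f y ≡ 0) → ΣN f ≡ f x
  ΣN-single {f} (inj₁ v) f≗0 = trans
    (cong₂ _+_ (ΣF-single n v (λ i i≢v → f≗0 _ (i≢v ∘ Sum.inj₁-injective)))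
               (ΣF-zero m (λ e → f≗0 _ λ ())))
    (ℕ.+-identityʳ _)
  ΣN-single {f} (inj₂ e) f≗0 =
    cong₂ _+_ (ΣF-zero n (λ v → f≗0 _ λ ()))
              (ΣF-single m e (λ i i≢e → f≗0 _ (i≢e ∘ Sum.inj₂-injective)))

  ΣN-indicator : ∀ x → ΣN (λ y → ⟦ ⌊ y ≟N x ⌋ ⟧) ≡ 1
  ΣN-indicator x = trans (ΣN-single x (λ y y≢x → cong ⟦_⟧ (⌊⌋-no (y ≟N x) y≢x)))
                         (cong ⟦_⟧ (⌊⌋-yes (x ≟N x) refl))

  #N : (Node → Bool) → ℕ
  #N c = ΣN (λ x → ⟦ c x ⟧)

  #N-complement : ∀ c → #N c + #N (not ∘ c) ≡ n + m
  #N-complement c = trans (sym (ΣN-+ (⟦_⟧ ∘ c) (⟦_⟧ ∘ not ∘ c)))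
    (cong₂ _+_ (ΣF-one n (λ v → one (c (inj₁ v)))) (ΣF-one m (λ e → one (c (inj₂ e)))))
    where
    one : ∀ x → ⟦ x ⟧ + ⟦ not x ⟧ ≡ 1
    one true  = refl
    one false = refl

  flipE-involutive : ∀ b → flipE (flipE b) ≡ b
  flipE-involutive (e , s) = cong (e ,_) (Bool.not-involutive s)

  flipE-≢ : ∀ b → flipE b ≢ b
  flipE-≢ (e , true)  ()
  flipE-≢ (e , false) ()

  emer-≡ : ∀ b β → emer β ≡ emer b → β ≡ b ⊎ β ≡ flipE b
  emer-≡ (e , false) (.e , false) refl = inj₁ refl
  emer-≡ (e , false) (.e , true)  refl = inj₂ refl
  emer-≡ (e , true)  (.e , false) refl = inj₂ refl
  emer-≡ (e , true)  (.e , true)  refl = inj₁ refl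

  -- Two-colourings and paths

  Mono : (Node → Bool) → BEdge → Set
  Mono c b = c (inj₁ (vert b)) ≡ c (inj₂ (emer b))

  Mono? : ∀ c b → Dec (Mono c b)
  Mono? c b = c (inj₁ (vert b)) Bool.≟ c (inj₂ (emer b))

  Closed : Sub → (Node → Bool) → Set
  Closed S c = ∀ b → S b ≡ true → Mono c b

  link-colour : ∀ {S c b x y} → Link S b x y → Mono c b → c x ≡ c y
  link-colour (_ , inj₁ (refl , refl)) eq = eq
  link-colour (_ , inj₂ (refl , refl)) eq = sym eq

  reach-colour : ∀ {S} c {x y} → Closed S c → Reach S x y → c x ≡ c y
  reach-colour     c closed here          = refl
  reach-colour {S} c closed (there b r l) =
    trans (reach-colour c closed r) (link-colour {S} {c} l (closed b (proj₁ l)))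

  reach-trans : ∀ {S x y z} → Reach S x y → Reach S y z → Reach S x z
  reach-trans r here          = r
  reach-trans r (there b q l) = there b (reach-trans r q) l

  link-sym : ∀ {S b x y} → Link S b x y → Link S b y x
  link-sym (t , inj₁ (p , q)) = t , inj₂ (q , p)
  link-sym (t , inj₂ (p , q)) = t , inj₁ (q , p)

  reach-sym : ∀ {S x y} → Reach S x y → Reach S y x
  reach-sym     here          = here
  reach-sym {S} (there b r l) = reach-trans (there b here (link-sym {S} {b} l)) (reach-sym r)

  -- Growing a node set along a subgraph

  inside : (Node → Bool) → BEdge → Bool
  inside c b = c (inj₁ (vert b)) ∧ c (inj₂ (emer b))

  outside : Sub → (Node → Bool) → Sub
  outside S c b = S b ∧ not (inside c b)

  -- Growing c along S adds one node per edge that becomes internal.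
  closure : ∀ S c k → #N (not ∘ c) ≡ k →
            ∃[ c′ ] (∀ x → c x ≡ true → c′ x ≡ true) × Closed S c′
                  × k ≤ numEdges (outside S c) + #N (not ∘ c′)
  closure S c k k≡ with anyB? (λ b → (S b Bool.≟ true) ×-dec (c (inj₁ (vert b)) Bool.≟ not (c (inj₂ (emer b)))))
  ... | no none = c , (λ _ p → p) , closed ,
                  subst (_≤ numEdges (outside S c) + #N (not ∘ c)) k≡ (ℕ.m≤n+m _ (numEdges (outside S c)))
    where
    closed : Closed S c
    closed b t with Mono? c b
    ... | yes p = p
    ... | no ¬p = contradiction (b , t , Bool.¬-not ¬p) none
  ... | yes (b , t , crossing) = grow k k≡
    where
    -- The end of the crossing edge `b` that is not yet in `c`; adding it makes `b` internal.
    y : Node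
    y = if c (inj₁ (vert b)) then inj₂ (emer b) else inj₁ (vert b)
    cy : c y ≡ false
    cy with c (inj₁ (vert b)) in eq
    ... | true  = trans (sym (Bool.not-involutive _)) (cong not (sym crossing))
    ... | false = eq
    c₁ : Node → Bool
    c₁ x = c x ∨ ⌊ x ≟N y ⌋
    c≤c₁ : ∀ x → c x ≡ true → c₁ x ≡ true
    c≤c₁ x p rewrite p = refl
    b-inside : inside c₁ b ≡ true
    b-inside = cover (c (inj₁ (vert b))) (c (inj₂ (emer b))) refl refl
      where
      cover : ∀ p q → c (inj₁ (vert b)) ≡ p → c (inj₂ (emer b)) ≡ q → inside c₁ b ≡ true
      cover true  q pv pe rewrite pv = trans (cong (c (inj₂ (emer b)) ∨_) (⌊⌋-yes (inj₂ (emer b) ≟N inj₂ (emer b)) refl)) (Bool.∨-zeroʳ _)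
      cover false true pv pe rewrite pv | pe =
        trans (Bool.∧-identityʳ _) (⌊⌋-yes (inj₁ (vert b) ≟N inj₁ (vert b)) refl)
      cover false false pv pe = case trans (sym pv) (trans crossing (cong not pe)) of λ ()
    b-not-inside : inside c b ≡ false
    b-not-inside rewrite crossing = Bool.∧-inverseˡ (c (inj₂ (emer b)))
    split : ∀ x → ⟦ not (c x) ⟧ ≡ ⟦ not (c₁ x) ⟧ + ⟦ ⌊ x ≟N y ⌋ ⟧
    split x with x ≟N y
    ... | yes refl rewrite cy = refl
    ... | no _ rewrite Bool.∨-identityʳ (c x) = sym (ℕ.+-identityʳ _)
    #N-split : #N (not ∘ c) ≡ suc (#N (not ∘ c₁))
    #N-split = begin
      #N (not ∘ c)                                    ≡⟨ ΣN-cong split ⟩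
      ΣN (λ x → ⟦ not (c₁ x) ⟧ + ⟦ ⌊ x ≟N y ⌋ ⟧)      ≡⟨ ΣN-+ (λ x → ⟦ not (c₁ x) ⟧) (λ x → ⟦ ⌊ x ≟N y ⌋ ⟧) ⟩
      #N (not ∘ c₁) + ΣN (λ x → ⟦ ⌊ x ≟N y ⌋ ⟧)       ≡⟨ cong (#N (not ∘ c₁) +_) (ΣN-indicator y) ⟩
      #N (not ∘ c₁) + 1                               ≡⟨ ℕ.+-comm _ 1 ⟩
      suc (#N (not ∘ c₁))                             ∎
      where open ≡-Reasoning
    inside-mono : ∀ β → inside c β ≡ true → inside c₁ β ≡ true
    inside-mono β p with c (inj₁ (vert β)) | c (inj₂ (emer β))
    ... | true | true = refl
    edge-split : ∀ β → ⟦ outside S c₁ β ⟧ + ⟦ ⌊ β ≟B b ⌋ ⟧ ≤ ⟦ outside S c β ⟧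
    edge-split β with β ≟B b
    ... | yes refl rewrite t | b-inside | b-not-inside = ℕ.≤-refl
    ... | no _ rewrite ℕ.+-identityʳ ⟦ outside S c₁ β ⟧ with S β
    ...   | false = z≤n
    ...   | true with inside c β in eq
    ...     | true  rewrite inside-mono β eq = z≤n
    ...     | false = ⟦⟧≤1 (not (inside c₁ β))
    edges : suc (numEdges (outside S c₁)) ≤ numEdges (outside S c)
    edges = begin
      suc (numEdges (outside S c₁))                       ≡⟨ ℕ.+-comm 1 _ ⟩
      numEdges (outside S c₁) + 1                         ≡⟨ cong (numEdges (outside S c₁) +_) (ΣB-indicator b) ⟨
      numEdges (outside S c₁) + ΣB (λ β → ⟦ ⌊ β ≟B b ⌋ ⟧) ≡⟨ ΣB-+ (⟦_⟧ ∘ outside S c₁) (λ β → ⟦ ⌊ β ≟B b ⌋ ⟧) ⟨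
      ΣB (λ β → ⟦ outside S c₁ β ⟧ + ⟦ ⌊ β ≟B b ⌋ ⟧)      ≤⟨ ΣB-mono edge-split ⟩
      numEdges (outside S c)                              ∎
      where open ℕ.≤-Reasoning
    -- `k` counts the nodes still outside `c` and makes the recursion structural; `k = 0` cannot
    -- occur because `y` is one of them.
    grow : ∀ k → #N (not ∘ c) ≡ k →
           ∃[ c′ ] (∀ x → c x ≡ true → c′ x ≡ true) × Closed S c′
                 × k ≤ numEdges (outside S c) + #N (not ∘ c′)
    grow zero    k≡ = case trans (sym #N-split) k≡ of λ ()
    grow (suc k) k≡ with closure S c₁ k (ℕ.suc-injective (trans (sym #N-split) k≡))
    ... | c′ , c₁≤c′ , closed , bound =
      c′ , (λ x p → c₁≤c′ x (c≤c₁ x p)) , closed ,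
      ℕ.≤-trans (s≤s bound) (ℕ.+-monoˡ-≤ _ edges)

  -- When `S` is connected, the closure of a nonempty `c` is everything, so every node outside `c`
  -- was added by an edge of its own.
  outside-bound : ∀ {S} → Connected S → ∀ c x → c x ≡ true → #N (not ∘ c) ≤ numEdges (outside S c)
  outside-bound {S} connected c x cx with closure S c _ refl
  ... | c′ , c≤c′ , closed , bound = ℕ.≤-trans bound (ℕ.≤-reflexive
    (trans (cong (numEdges (outside S c) +_) (cong₂ _+_ (ΣF-zero n (λ v → empty _)) (ΣF-zero m (λ e → empty _))))
           (ℕ.+-identityʳ _)))
    where
    empty : ∀ y → ⟦ not (c′ y) ⟧ ≡ 0
    empty y = cong (⟦_⟧ ∘ not) (trans (sym (reach-colour c′ closed (connected x y))) (c≤c′ x cx))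

  -- Fundamental cuts of a spanning tree

  -- For a spanning tree this is the fundamental cut of `b`, oriented from the emerald end (`false`)
  -- to the violet end (`true`).
  record Cut (T : Sub) (b : BEdge) : Set where
    field
      colour     : Node → Bool
      emer-false : colour (inj₂ (emer b)) ≡ false
      vert-true  : colour (inj₁ (vert b)) ≡ true
      respects   : ∀ β → T β ≡ true → β ≢ b → Mono colour β

  delete : Sub → BEdge → Sub
  delete T b β = T β ∧ not ⌊ β ≟B b ⌋

  numEdges-delete : ∀ {T b} → T b ≡ true → numEdges T ≡ suc (numEdges (delete T b))
  numEdges-delete {T} {b} t = begin
    numEdges T                                          ≡⟨ ΣB-cong split ⟩
    ΣB (λ β → ⟦ delete T b β ⟧ + ⟦ ⌊ β ≟B b ⌋ ⟧)        ≡⟨ ΣB-+ (⟦_⟧ ∘ delete T b) (λ β → ⟦ ⌊ β ≟B b ⌋ ⟧) ⟩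
    numEdges (delete T b) + ΣB (λ β → ⟦ ⌊ β ≟B b ⌋ ⟧)   ≡⟨ cong (numEdges (delete T b) +_) (ΣB-indicator b) ⟩
    numEdges (delete T b) + 1                           ≡⟨ ℕ.+-comm _ 1 ⟩
    suc (numEdges (delete T b))                         ∎
    where
    open ≡-Reasoning
    split : ∀ β → ⟦ T β ⟧ ≡ ⟦ delete T b β ⟧ + ⟦ ⌊ β ≟B b ⌋ ⟧
    split β with β ≟B b
    ... | yes refl rewrite t = refl
    ... | no _ = sym (trans (ℕ.+-identityʳ _) (cong ⟦_⟧ (Bool.∧-identityʳ (T β))))

  outside-≤ : ∀ S c → numEdges (outside S c) ≤ numEdges S
  outside-≤ S c = ΣB-mono λ β → below (S β) (not (inside c β))
    where
    below : ∀ x y → ⟦ x ∧ y ⟧ ≤ ⟦ x ⟧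
    below true  y = ⟦⟧≤1 y
    below false y = z≤n

  abstract
    -- If vert b were still reached from emer b, the n + m − 2 edges of T − b would connect n + m nodes.
    cut : ∀ {T} → IsSpanningTree T → ∀ b → T b ≡ true → Cut T b
    cut {T} (connected , size) b t with closure (delete T b) (λ x → ⌊ x ≟N inj₂ (emer b) ⌋) _ refl
    ... | c , c₀≤c , closed , bound with c (inj₁ (vert b)) in eq
    -- The closure was grown from `emer b`, which has to be on the `false` side; hence the negation.
    ...   | false = record
      { colour     = not ∘ c
      ; emer-false = cong not (c₀≤c _ (⌊⌋-yes (inj₂ (emer b) ≟N inj₂ (emer b)) refl))
      ; vert-true  = cong not eq
      ; respects   = λ β tβ β≢b → cong not (closed β (trans (cong (_∧ not ⌊ β ≟B b ⌋) tβ)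
                                                           (cong not (⌊⌋-no (β ≟B b) β≢b))))
      }
    ...   | true = contradiction too-small (ℕ.<-irrefl refl)
      where
      ce : c (inj₂ (emer b)) ≡ true
      ce = c₀≤c _ (⌊⌋-yes (inj₂ (emer b) ≟N inj₂ (emer b)) refl)
      closed-T : Closed T c
      closed-T β tβ with β ≟B b
      ... | yes refl = trans eq (sym ce)
      ... | no β≢b   = closed β (trans (cong (_∧ not ⌊ β ≟B b ⌋) tβ) (cong not (⌊⌋-no (β ≟B b) β≢b)))
      all-true : ∀ x → c x ≡ true
      all-true x = trans (sym (reach-colour c closed-T (connected (inj₂ (emer b)) x))) ce
      c₀ : Node → Bool
      c₀ x = ⌊ x ≟N inj₂ (emer b) ⌋
      compl-c : #N (not ∘ c) ≡ 0
      compl-c = cong₂ _+_ (ΣF-zero n (λ v → cong (⟦_⟧ ∘ not) (all-true _)))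
                          (ΣF-zero m (λ e → cong (⟦_⟧ ∘ not) (all-true _)))
      #c₀ : #N c₀ ≡ 1
      #c₀ = ΣN-indicator (inj₂ (emer b))
      too-small : n + m < n + m
      too-small = begin
        suc (n + m)                                             ≡⟨ cong suc (trans (sym (#N-complement c₀)) (cong (_+ #N (not ∘ c₀)) #c₀)) ⟩
        suc (suc (#N (not ∘ c₀)))                               ≤⟨ s≤s (s≤s bound) ⟩
        suc (suc (numEdges (outside (delete T b) c₀) + #N (not ∘ c))) ≡⟨ cong (λ k → suc (suc k)) (trans (cong (numEdges (outside (delete T b) c₀) +_) compl-c) (ℕ.+-identityʳ _)) ⟩
        suc (suc (numEdges (outside (delete T b) c₀)))          ≤⟨ s≤s (s≤s (outside-≤ (delete T b) c₀)) ⟩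
        suc (suc (numEdges (delete T b)))                       ≡⟨ cong suc (numEdges-delete {T} {b} t) ⟨
        suc (numEdges T)                                        ≡⟨ ℕ.+-comm 1 _ ⟩
        numEdges T + 1                                          ≡⟨ size ⟩
        n + m                                                   ∎
        where open ℕ.≤-Reasoning

  -- Node degrees and transfers

  1≤ΣB : ∀ {f} b → 1 ≤ f b → 1 ≤ ΣB f
  1≤ΣB {f} b 1≤fb = subst (_≤ ΣB f) (ΣB-indicator b) (ΣB-mono below)
    where
    below : ∀ β → ⟦ ⌊ β ≟B b ⌋ ⟧ ≤ f β
    below β with β ≟B b
    ... | yes refl = 1≤fb
    ... | no _     = z≤n

  ΣB-indicator-∧ : ∀ b (p : BEdge → Bool) → ΣB (λ β → ⟦ ⌊ β ≟B b ⌋ ∧ p β ⟧) ≡ ⟦ p b ⟧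
  ΣB-indicator-∧ b p = trans
    (ΣB-single b (λ β β≢b → cong (λ x → ⟦ x ∧ p β ⟧) (⌊⌋-no (β ≟B b) β≢b)))
    (cong (λ x → ⟦ x ∧ p b ⟧) (⌊⌋-yes (b ≟B b) refl))

  -- Gives `degE` the form that `degV` has by definition, so that one exchange computation serves
  -- both colour classes.
  degE-sum : ∀ S e → degE S e ≡ ΣB (λ β → ⟦ S β ∧ ⌊ emer β ≟ e ⌋ ⟧)
  degE-sum S e = sym (trans
    (ΣF-single m e (λ i i≢e → cong₂ _+_ (off i (S (i , false)) i≢e) (off i (S (i , true)) i≢e)))
    (cong₂ _+_ (on (S (e , false))) (on (S (e , true)))))
    where
    off : ∀ i x → i ≢ e → ⟦ x ∧ ⌊ i ≟ e ⌋ ⟧ ≡ 0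
    off i x i≢e rewrite ⌊⌋-no (i ≟ e) i≢e = cong ⟦_⟧ (Bool.∧-zeroʳ x)
    on : ∀ x → ⟦ x ∧ ⌊ e ≟ e ⌋ ⟧ ≡ ⟦ x ⟧
    on x rewrite ⌊⌋-yes (e ≟ e) refl = cong ⟦_⟧ (Bool.∧-identityʳ x)

  degE-pos : ∀ {S} → Connected S → ∀ e → 1 ≤ degE S e
  degE-pos {S} connected e with connected (inj₁ (end e false)) (inj₂ e)
  ... | there (.e , s) _ (t , inj₁ (_ , refl)) =
    subst (1 ≤_) (sym (degE-sum S e)) (1≤ΣB {λ β → ⟦ S β ∧ ⌊ emer β ≟ e ⌋ ⟧} (e , s)
      (ℕ.≤-reflexive (sym (cong ⟦_⟧ (cong₂ _∧_ t (⌊⌋-yes (e ≟ e) refl))))))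

  -- The argument of type `Fin m` supplies a node other than `v` to start a path from: a single
  -- violet node without edges is connected but has degree 0.
  degV-pos : ∀ {S} → Connected S → Fin m → ∀ v → 1 ≤ degV S v
  degV-pos {S} connected e v with connected (inj₂ e) (inj₁ v)
  ... | there b _ (t , inj₂ (_ , refl)) = 1≤ΣB {λ β → ⟦ S β ∧ ⌊ vert β ≟ v ⌋ ⟧} b
    (ℕ.≤-reflexive (sym (cong ⟦_⟧ (cong₂ _∧_ t (⌊⌋-yes (vert b ≟ vert b) refl)))))

  -- The balance is additive because subtraction on ℕ truncates; positivity of both degree functions
  -- allows the predecessors to be undone.
  transfer-degree : ∀ {k} (d d′ : Fin k → ℕ) {x x′ : Fin k} → x ≢ x′ →
                    (∀ y → 1 ≤ d y) → (∀ y → 1 ≤ d′ y) →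
                    (∀ y → d′ y + ⟦ ⌊ x ≟ y ⌋ ⟧ ≡ d y + ⟦ ⌊ x′ ≟ y ⌋ ⟧) →
                    ∀ y → d′ y ≡ suc (transfer (λ z → d z ∸ 1) x x′ y)
  transfer-degree d d′ {x} {x′} x≢x′ d-pos d′-pos balance y with y ≟ x | y ≟ x′ | balance y
  ... | yes refl | _ | eq rewrite ⌊⌋-yes (x ≟ x) refl | ⌊⌋-no (x′ ≟ x) (x≢x′ ∘ sym) = begin
    d′ x              ≡⟨ ℕ.m+[n∸m]≡n (d′-pos x) ⟨
    suc (d′ x ∸ 1)    ≡⟨ cong (λ k → suc (k ∸ 1)) (ℕ.m+n∸n≡m (d′ x) 1) ⟨
    suc (d′ x + 1 ∸ 1 ∸ 1) ≡⟨ cong (λ k → suc (k ∸ 1 ∸ 1)) (trans eq (ℕ.+-identityʳ _)) ⟩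
    suc (d x ∸ 1 ∸ 1) ∎
    where open ≡-Reasoning
  ... | no y≢x | yes refl | eq rewrite ⌊⌋-no (x ≟ y) (y≢x ∘ sym) | ⌊⌋-yes (y ≟ y) refl = begin
    d′ y              ≡⟨ ℕ.+-identityʳ _ ⟨
    d′ y + 0          ≡⟨ eq ⟩
    d y + 1           ≡⟨ ℕ.+-comm _ 1 ⟩
    suc (d y)         ≡⟨ cong suc (ℕ.m+[n∸m]≡n (d-pos y)) ⟨
    suc (suc (d y ∸ 1)) ∎
    where open ≡-Reasoning
  ... | no y≢x | no y≢x′ | eq rewrite ⌊⌋-no (x ≟ y) (y≢x ∘ sym) | ⌊⌋-no (x′ ≟ y) (y≢x′ ∘ sym) =
    trans (trans (sym (ℕ.+-identityʳ _)) (trans eq (ℕ.+-identityʳ _)))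
          (sym (ℕ.m+[n∸m]≡n (d-pos y)))

  -- Exchanging a tree edge across its cut

  exchange : Sub → BEdge → BEdge → Sub
  exchange T b b′ β = delete T b β ∨ ⌊ β ≟B b′ ⌋

  module Exchange {T b b′} (spanning : IsSpanningTree T) (t : T b ≡ true) (C : Cut T b)
                  (e-true : Cut.colour C (inj₂ (emer b′)) ≡ true)
                  (v-false : Cut.colour C (inj₁ (vert b′)) ≡ false) where
    open Cut C

    T′ : Sub
    T′ = exchange T b b′

    emer-≢ : emer b ≢ emer b′
    emer-≢ eq = case trans (sym e-true) (trans (cong (colour ∘ inj₂) (sym eq)) emer-false) of λ ()

    vert-≢ : vert b ≢ vert b′
    vert-≢ eq = case trans (sym vert-true) (trans (cong (colour ∘ inj₁) eq) v-false) of λ ()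

    b′≢b : b′ ≢ b
    b′≢b eq = emer-≢ (cong emer (sym eq))

    b′∉T : T b′ ≡ false
    b′∉T = not-true (λ t′ → case trans (sym v-false) (trans (respects b′ t′ b′≢b) e-true) of λ ())

    -- A constant `p` gives the number of edges, the star of a node as `p` gives its degree. Only
    -- `b` and `b′` contribute differently to `T` and `T′`.
    balance : ∀ (p : BEdge → Bool) → ΣB (λ β → ⟦ T′ β ∧ p β ⟧) + ⟦ p b ⟧ ≡ ΣB (λ β → ⟦ T β ∧ p β ⟧) + ⟦ p b′ ⟧
    balance p = begin
      ΣB (λ β → ⟦ T′ β ∧ p β ⟧) + ⟦ p b ⟧
        ≡⟨ cong (ΣB (λ β → ⟦ T′ β ∧ p β ⟧) +_) (ΣB-indicator-∧ b p) ⟨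
      ΣB (λ β → ⟦ T′ β ∧ p β ⟧) + ΣB (λ β → ⟦ ⌊ β ≟B b ⌋ ∧ p β ⟧)
        ≡⟨ ΣB-+ (λ β → ⟦ T′ β ∧ p β ⟧) (λ β → ⟦ ⌊ β ≟B b ⌋ ∧ p β ⟧) ⟨
      ΣB (λ β → ⟦ T′ β ∧ p β ⟧ + ⟦ ⌊ β ≟B b ⌋ ∧ p β ⟧)
        ≡⟨ ΣB-cong pointwise ⟩
      ΣB (λ β → ⟦ T β ∧ p β ⟧ + ⟦ ⌊ β ≟B b′ ⌋ ∧ p β ⟧)
        ≡⟨ ΣB-+ (λ β → ⟦ T β ∧ p β ⟧) (λ β → ⟦ ⌊ β ≟B b′ ⌋ ∧ p β ⟧) ⟩
      ΣB (λ β → ⟦ T β ∧ p β ⟧) + ΣB (λ β → ⟦ ⌊ β ≟B b′ ⌋ ∧ p β ⟧)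
        ≡⟨ cong (ΣB (λ β → ⟦ T β ∧ p β ⟧) +_) (ΣB-indicator-∧ b′ p) ⟩
      ΣB (λ β → ⟦ T β ∧ p β ⟧) + ⟦ p b′ ⟧ ∎
      where
      open ≡-Reasoning
      removed : ∀ {x q} → x ≡ true → ⟦ (x ∧ false ∨ false) ∧ q ⟧ + ⟦ q ⟧ ≡ ⟦ x ∧ q ⟧ + 0
      removed refl = ℕ.+-comm 0 _
      inserted : ∀ {x q} → x ≡ false → ⟦ (x ∧ true ∨ true) ∧ q ⟧ + 0 ≡ ⟦ x ∧ q ⟧ + ⟦ q ⟧
      inserted refl = ℕ.+-comm _ 0
      pointwise : ∀ β → ⟦ T′ β ∧ p β ⟧ + ⟦ ⌊ β ≟B b ⌋ ∧ p β ⟧ ≡ ⟦ T β ∧ p β ⟧ + ⟦ ⌊ β ≟B b′ ⌋ ∧ p β ⟧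
      pointwise β with β ≟B b | β ≟B b′
      ... | yes p    | yes q    = contradiction (trans (sym q) p) b′≢b
      ... | yes refl | no _     = removed t
      ... | no _     | yes refl = inserted b′∉T
      ... | no _     | no _     rewrite Bool.∨-identityʳ (T β ∧ true) | Bool.∧-identityʳ (T β) = refl

    size : numEdges T′ ≡ numEdges T
    size = begin
      numEdges T′                   ≡⟨ ΣB-cong (λ β → cong ⟦_⟧ (Bool.∧-identityʳ (T′ β))) ⟨
      ΣB (λ β → ⟦ T′ β ∧ true ⟧)    ≡⟨ ℕ.+-cancelʳ-≡ 1 _ _ (balance (λ _ → true)) ⟩
      ΣB (λ β → ⟦ T β ∧ true ⟧)     ≡⟨ ΣB-cong (λ β → cong ⟦_⟧ (Bool.∧-identityʳ (T β))) ⟩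
      numEdges T                    ∎
      where open ≡-Reasoning

    kept : ∀ β → T β ≡ true → β ≢ b → T′ β ≡ true
    kept β tβ β≢b rewrite tβ | ⌊⌋-no (β ≟B b) β≢b = refl

    added : T′ b′ ≡ true
    added rewrite ⌊⌋-yes (b′ ≟B b′) refl = Bool.∨-zeroʳ (delete T b b′)

    apex : Bool → Node
    apex false = inj₂ (emer b)
    apex true  = inj₁ (vert b)

    from-apex : ∀ {z} → Reach T (inj₂ (emer b)) z → Reach T′ (apex (colour z)) z
    from-apex here rewrite emer-false = here
    from-apex (there {y} {z} β r l) with β ≟B b
    ... | no β≢b = there β
      (subst (λ x → Reach T′ (apex x) y) (link-colour {T} {colour} l (respects β (proj₁ l) β≢b)) (from-apex r))
      (kept β (proj₁ l) β≢b , proj₂ l)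
    from-apex (there β r (_ , inj₁ (refl , refl))) | yes refl rewrite emer-false = here
    from-apex (there β r (_ , inj₂ (refl , refl))) | yes refl rewrite vert-true = here

    from-emer : ∀ z → Reach T′ (inj₂ (emer b)) z
    from-emer z with colour z in eq
    ... | false = subst (λ x → Reach T′ (apex x) z) eq (from-apex (proj₁ spanning _ z))
    ... | true  = reach-trans to-vert (subst (λ x → Reach T′ (apex x) z) eq (from-apex (proj₁ spanning _ z)))
      where
      -- `b′` replaces `b`: stay on the false side up to `vert b′`, cross to `emer b′`, then run
      -- back on the true side to `vert b`.
      to-vert : Reach T′ (inj₂ (emer b)) (inj₁ (vert b))
      to-vert = reach-trans
        (there b′ (subst (λ x → Reach T′ (apex x) _) v-false (from-apex (proj₁ spanning _ _)))
                  (added , inj₁ (refl , refl)))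
        (reach-sym (subst (λ x → Reach T′ (apex x) _) e-true (from-apex (proj₁ spanning _ _))))

    connected : Connected T′
    connected x y = reach-trans (reach-sym (from-emer x)) (from-emer y)

    isSpanningTree : IsSpanningTree T′
    isSpanningTree = connected , trans (cong (_+ 1) size) (proj₂ spanning)

    degE-balance : ∀ y → degE T′ y + ⟦ ⌊ emer b ≟ y ⌋ ⟧ ≡ degE T y + ⟦ ⌊ emer b′ ≟ y ⌋ ⟧
    degE-balance y rewrite degE-sum T′ y | degE-sum T y = balance (λ β → ⌊ emer β ≟ y ⌋)

    hypertreeE : IsHypertreeE (transfer (fE T) (emer b) (emer b′))
    hypertreeE = T′ , isSpanningTree ,
      transfer-degree (degE T) (degE T′) emer-≢ (degE-pos (proj₁ spanning)) (degE-pos connected) degE-balance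

    degV-balance : ∀ y → degV T′ y + ⟦ ⌊ vert b ≟ y ⌋ ⟧ ≡ degV T y + ⟦ ⌊ vert b′ ≟ y ⌋ ⟧
    degV-balance y = balance (λ β → ⌊ vert β ≟ y ⌋)

    degV-T′-pos : ∀ y → 1 ≤ degV T′ y
    degV-T′-pos = degV-pos connected (emer b)

    hypertreeV : IsHypertreeV (transfer (fV T) (vert b) (vert b′))
    hypertreeV = T′ , isSpanningTree ,
      transfer-degree (degV T) (degV T′) vert-≢ (degV-pos (proj₁ spanning) (emer b)) degV-T′-pos degV-balance

    -- Besides `b`, the node `vert b` has in `T` the edges that it keeps in the spanning tree `T′`,
    -- and there is at least one.
    fV-pos : 1 ≤ fV T (vert b)
    fV-pos = ℕ.∸-monoˡ-≤ 1 (begin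
      2                    ≡⟨⟩
      1 + 1                ≤⟨ ℕ.+-monoˡ-≤ 1 (degV-T′-pos (vert b)) ⟩
      degV T′ (vert b) + 1 ≡⟨ cong (λ x → degV T′ (vert b) + ⟦ x ⟧) (⌊⌋-yes (vert b ≟ vert b) refl) ⟨
      degV T′ (vert b) + ⟦ ⌊ vert b ≟ vert b ⌋ ⟧ ≡⟨ degV-balance (vert b) ⟩
      degV T (vert b) + ⟦ ⌊ vert b′ ≟ vert b ⌋ ⟧ ≡⟨ cong (λ x → degV T (vert b) + ⟦ x ⟧) (⌊⌋-no (vert b′ ≟ vert b) (vert-≢ ∘ sym)) ⟩
      degV T (vert b) + 0  ≡⟨ ℕ.+-identityʳ _ ⟩
      degV T (vert b)      ∎)
      where open ℕ.≤-Reasoning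

  -- Degree sums on one side of a cut

  -- Double counting: after the sums are swapped, each half-edge contributes only at its own violet
  -- end.
  degV-weighted : ∀ S (w : Fin n → Bool) →
                  ΣF n (λ v → ⟦ w v ⟧ * degV S v) ≡ ΣB (λ b → ⟦ S b ∧ w (vert b) ⟧)
  degV-weighted S w = begin
    ΣF n (λ v → ⟦ w v ⟧ * degV S v)                 ≡⟨ ΣF-cong n (λ v → ΣF-*ˡ m ⟦ w v ⟧ _) ⟩
    ΣF n (λ v → ΣF m (λ e → ⟦ w v ⟧ * (f v (e , false) + f v (e , true))))
                                                    ≡⟨ ΣF-swap n m _ ⟩
    ΣF m (λ e → ΣF n (λ v → ⟦ w v ⟧ * (f v (e , false) + f v (e , true))))
                                                    ≡⟨ ΣF-cong m (λ e → ΣF-cong n (λ v → ℕ.*-distribˡ-+ ⟦ w v ⟧ (f v (e , false)) _)) ⟩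
    ΣF m (λ e → ΣF n (λ v → ⟦ w v ⟧ * f v (e , false) + ⟦ w v ⟧ * f v (e , true)))
                                                    ≡⟨ ΣF-cong m (λ e → ΣF-+ n _ _) ⟩
    ΣB (λ b → ΣF n (λ v → ⟦ w v ⟧ * f v b))         ≡⟨ ΣB-cong collapse ⟩
    ΣB (λ b → ⟦ S b ∧ w (vert b) ⟧)                 ∎
    where
    open ≡-Reasoning
    f : Fin n → BEdge → ℕ
    f v b = ⟦ S b ∧ ⌊ vert b ≟ v ⌋ ⟧
    collapse : ∀ b → ΣF n (λ v → ⟦ w v ⟧ * f v b) ≡ ⟦ S b ∧ w (vert b) ⟧
    collapse b = trans (ΣF-single n (vert b) off) on
      where
      off : ∀ v → v ≢ vert b → ⟦ w v ⟧ * f v b ≡ 0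
      off v v≢ rewrite ⌊⌋-no (vert b ≟ v) (v≢ ∘ sym) | Bool.∧-zeroʳ (S b) = ℕ.*-zeroʳ ⟦ w v ⟧
      on : ⟦ w (vert b) ⟧ * f (vert b) b ≡ ⟦ S b ∧ w (vert b) ⟧
      on rewrite ⌊⌋-yes (vert b ≟ vert b) refl with S b | w (vert b)
      ... | true  | true  = refl
      ... | true  | false = refl
      ... | false | true  = refl
      ... | false | false = refl

  -- Without an edge from a true emerald node to a false violet node, the true violet nodes
  -- meet at least #N colour edges of any spanning tree, and T attains this bound; so no
  -- degree can be moved from a true violet node to a false one.
  module _ {T b} (spanning : IsSpanningTree T) (t : T b ≡ true) (C : Cut T b) where
    open Cut C

    crossing-edge : ∀ {v′} → colour (inj₁ v′) ≡ false → 1 ≤ fV T (vert b) →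
                    IsHypertreeV (transfer (fV T) (vert b) v′) →
                    ∃[ b′ ] colour (inj₂ (emer b′)) ≡ true × colour (inj₁ (vert b′)) ≡ false
    crossing-edge {v′} v′-false 1≤f (T′ , (connected′ , _) , deg′)
      with anyB? (λ b′ → (colour (inj₂ (emer b′)) Bool.≟ true) ×-dec (colour (inj₁ (vert b′)) Bool.≟ false))
    ... | yes found = found
    ... | no none = contradiction too-many (ℕ.<-irrefl refl)
      where
      w : Fin n → Bool
      w v = colour (inj₁ v)
      meets : Sub → BEdge → ℕ
      meets S β = ⟦ S β ∧ w (vert β) ⟧
      no-crossing : ∀ β → colour (inj₂ (emer β)) ≡ true → w (vert β) ≡ true
      no-crossing β p = Bool.¬-not (λ q → none (β , p , q))
      -- Attaching the true nodes to the false ones takes at least `#N colour` edges with a true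
      -- end; without a crossing edge the violet end of each of them is true.
      lower : #N colour ≤ ΣB (meets T′)
      lower = begin
        #N colour                           ≡⟨ ΣN-cong (λ x → cong ⟦_⟧ (Bool.not-involutive (colour x))) ⟨
        #N (not ∘ not ∘ colour)             ≤⟨ outside-bound connected′ (not ∘ colour) (inj₂ (emer b)) (cong not emer-false) ⟩
        numEdges (outside T′ (not ∘ colour)) ≤⟨ ΣB-mono (λ β → pointwise β (colour (inj₂ (emer β))) (no-crossing β)) ⟩
        ΣB (meets T′)                       ∎
        where
        open ℕ.≤-Reasoning
        pointwise : ∀ β x → (x ≡ true → w (vert β) ≡ true) →
                    ⟦ T′ β ∧ not (not (w (vert β)) ∧ not x) ⟧ ≤ ⟦ T′ β ∧ w (vert β) ⟧
        pointwise β x p with T′ β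
        ... | false = z≤n
        ... | true with w (vert β) | x
        ...   | true  | _     = ℕ.≤-refl
        ...   | false | false = z≤n
        ...   | false | true  = case p refl of λ ()
      -- An edge of `T` other than `b` is counted once, by `meets` if it is on the true side and by
      -- `outside` if it is on the false side. The edge `b` is counted twice, which turns
      -- `numEdges T` into `n + m`.
      upper : ΣB (meets T) ≤ #N colour
      upper = ℕ.+-cancelʳ-≤ (#N (not ∘ colour)) _ _ (begin
        ΣB (meets T) + #N (not ∘ colour)
          ≤⟨ ℕ.+-monoʳ-≤ (ΣB (meets T)) (outside-bound (proj₁ spanning) colour (inj₁ (vert b)) vert-true) ⟩
        ΣB (meets T) + numEdges (outside T colour)
          ≡⟨ ΣB-+ (meets T) (⟦_⟧ ∘ outside T colour) ⟨
        ΣB (λ β → meets T β + ⟦ outside T colour β ⟧)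
          ≡⟨ ΣB-cong pointwise ⟩
        ΣB (λ β → ⟦ T β ⟧ + ⟦ ⌊ β ≟B b ⌋ ⟧)
          ≡⟨ ΣB-+ (⟦_⟧ ∘ T) (λ β → ⟦ ⌊ β ≟B b ⌋ ⟧) ⟩
        numEdges T + ΣB (λ β → ⟦ ⌊ β ≟B b ⌋ ⟧)
          ≡⟨ cong (numEdges T +_) (ΣB-indicator b) ⟩
        numEdges T + 1
          ≡⟨ trans (proj₂ spanning) (sym (#N-complement colour)) ⟩
        #N colour + #N (not ∘ colour) ∎)
        where
        open ℕ.≤-Reasoning
        mono-count : ∀ x y → x ≡ y → ⟦ x ⟧ + ⟦ not (x ∧ y) ⟧ ≡ 1
        mono-count true  _ refl = refl
        mono-count false _ refl = refl
        pointwise : ∀ β → meets T β + ⟦ outside T colour β ⟧ ≡ ⟦ T β ⟧ + ⟦ ⌊ β ≟B b ⌋ ⟧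
        pointwise β with β ≟B b
        ... | yes refl rewrite t | vert-true | emer-false = refl
        ... | no β≢b with T β in eq
        ...   | false = refl
        ...   | true  = mono-count _ _ (respects β eq β≢b)
      -- The transfer takes one unit from the true node `vert b` and gives it to the false node
      -- `v′`, which has weight 0.
      drop : ΣB (meets T′) < ΣB (meets T)
      drop = begin-strict
        ΣB (meets T′)                     ≡⟨ degV-weighted T′ w ⟨
        ΣF n (λ v → ⟦ w v ⟧ * degV T′ v)  <⟨ ℕ.≤-reflexive (ℕ.+-comm 1 _) ⟩
        ΣF n (λ v → ⟦ w v ⟧ * degV T′ v) + 1
          ≡⟨ cong (ΣF n (λ v → ⟦ w v ⟧ * degV T′ v) +_)
               (trans (ΣF-single n (vert b) (λ v v≢ → cong ⟦_⟧ (⌊⌋-no (v ≟ vert b) v≢)))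
                      (cong ⟦_⟧ (⌊⌋-yes (vert b ≟ vert b) refl))) ⟨
        ΣF n (λ v → ⟦ w v ⟧ * degV T′ v) + ΣF n (λ v → ⟦ ⌊ v ≟ vert b ⌋ ⟧)
          ≡⟨ ΣF-+ n (λ v → ⟦ w v ⟧ * degV T′ v) (λ v → ⟦ ⌊ v ≟ vert b ⌋ ⟧) ⟨
        ΣF n (λ v → ⟦ w v ⟧ * degV T′ v + ⟦ ⌊ v ≟ vert b ⌋ ⟧)
          ≡⟨ ΣF-cong n pointwise ⟩
        ΣF n (λ v → ⟦ w v ⟧ * degV T v)   ≡⟨ degV-weighted T w ⟩
        ΣB (meets T)                      ∎
        where
        open ℕ.≤-Reasoning
        -- `1 ≤ fV` means degree at least 2, so the two truncated predecessors really subtract.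
        pred-pred : ∀ d → 1 ≤ d ∸ 1 → suc (d ∸ 1 ∸ 1) + 0 + 1 ≡ d + 0
        pred-pred (suc (suc d)) _ = ℕ.+-comm _ 1
        pointwise : ∀ v → ⟦ w v ⟧ * degV T′ v + ⟦ ⌊ v ≟ vert b ⌋ ⟧ ≡ ⟦ w v ⟧ * degV T v
        pointwise v rewrite deg′ v with v ≟ vert b
        ... | yes refl rewrite vert-true = pred-pred (degV T v) 1≤f
        ... | no _ with v ≟ v′
        ...   | yes refl rewrite v′-false = refl
        ...   | no _ = trans (ℕ.+-identityʳ _)
                             (cong (⟦ w v ⟧ *_) (ℕ.m+[n∸m]≡n (degV-pos (proj₁ spanning) (emer b) v)))
      too-many : #N colour < #N colour
      too-many = ℕ.≤-<-trans lower (ℕ.<-≤-trans drop upper)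

-- The tour as a permutation of the states

bit : Bool → Fin 2
bit false = zero
bit true  = suc zero

bit-injective : ∀ {x y} → bit x ≡ bit y → x ≡ y
bit-injective {false} {false} _ = refl
bit-injective {true}  {true}  _ = refl

module Tour {n m : ℕ} {end : Fin m → Bool → Fin n} (ρ : Bip.Ribbon end) (start : Bip.State end)
            (T : Bip.Sub end) (spanning : Bip.IsSpanningTree end T) where
  open Bip end
  open Subdivision end
  open Ribbon ρ

  infix 4 _≟S_

  _≟S_ : DecidableEquality State
  _≟S_ = ≡-dec _≟B_ Bool._≟_

  node : State → Node
  node (b , true)  = inj₁ (vert b)
  node (b , false) = inj₂ (emer b)

  -- A step is `rot ∘ cross`: first walk along the current edge if it is in `T`, then turn at the
  -- node reached. The first factor is an involution and the second is injective, so the step is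
  -- injective.
  cross : State → State
  cross (b , f) = b , (if T b then not f else f)

  rot : State → State
  rot (b , true)  = σ b , true
  rot (b , false) = flipE b , false

  next : State → State
  next = step ρ T

  next≡rot∘cross : ∀ s → next s ≡ rot (cross s)
  next≡rot∘cross (b , true)  with T b
  ... | true  = refl
  ... | false = refl
  next≡rot∘cross (b , false) with T b
  ... | true  = refl
  ... | false = refl

  cross-involutive : ∀ s → cross (cross s) ≡ s
  cross-involutive (b , f) with T b
  ... | true  = cong (b ,_) (Bool.not-involutive f)
  ... | false = refl

  rot-injective : ∀ {s s′} → rot s ≡ rot s′ → s ≡ s′
  rot-injective {b , true}  {b′ , true}  eq = cong (_, true) (σ-inj b b′ (cong proj₁ eq))
  rot-injective {b , false} {b′ , false} eq = cong (_, false)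
    (trans (sym (flipE-involutive b)) (trans (cong (flipE ∘ proj₁) eq) (flipE-involutive b′)))
  rot-injective {b , true}  {b′ , false} eq = case cong proj₂ eq of λ ()
  rot-injective {b , false} {b′ , true}  eq = case cong proj₂ eq of λ ()

  next-injective : ∀ {s s′} → next s ≡ next s′ → s ≡ s′
  next-injective {s} {s′} eq = begin
    s                ≡⟨ cross-involutive s ⟨
    cross (cross s)  ≡⟨ cong cross (rot-injective (trans (sym (next≡rot∘cross s)) (trans eq (next≡rot∘cross s′)))) ⟩
    cross (cross s′) ≡⟨ cross-involutive s′ ⟩
    s′               ∎
    where open ≡-Reasoning

  next-edge : ∀ b f → T b ≡ true → next (b , f) ≡ rot (b , not f)
  next-edge b f t = trans (next≡rot∘cross (b , f)) (cong (λ x → rot (b , (if x then not f else f))) t)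

  next-nonedge : ∀ b f → T b ≡ false → next (b , f) ≡ rot (b , f)
  next-nonedge b f t = trans (next≡rot∘cross (b , f)) (cong (λ x → rot (b , (if x then not f else f))) t)

  node-rot : ∀ s → node (rot s) ≡ node s
  node-rot (b , true)  = cong inj₁ (σ-vert b)
  node-rot (b , false) = refl

  state-code : State → Fin (m * 2 * 2)
  state-code ((e , s) , f) = combine (combine e (bit s)) (bit f)

  state-code-injective : ∀ {s s′} → state-code s ≡ state-code s′ → s ≡ s′
  state-code-injective {(e , s) , f} {(e′ , s′) , f′} eq
    with es , ff ← Fin.combine-injective (combine e (bit s)) (bit f) (combine e′ (bit s′)) (bit f′) eq
    with ee , ss ← Fin.combine-injective e (bit s) e′ (bit s′) es
    = cong₂ _,_ (cong₂ _,_ ee (bit-injective ss)) (bit-injective ff)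

  -- Colours of a cut along the tour

  module Colour {b} (t : T b ≡ true) where
    open Cut (cut spanning b t) public

    Crossing : BEdge → Set
    Crossing b′ = colour (inj₂ (emer b′)) ≡ true × colour (inj₁ (vert b′)) ≡ false

    colour-end : ∀ f → colour (node (b , f)) ≡ f
    colour-end true  = vert-true
    colour-end false = emer-false

    -- Turning keeps the node, and walking along an edge of `T` other than `b` keeps the colour.
    colour-next : ∀ s → s ≢ (b , true) → s ≢ (b , false) → colour (node (next s)) ≡ colour (node s)
    colour-next (β , f) ≢v ≢e = trans (cong (colour ∘ node) (next≡rot∘cross (β , f)))
                               (trans (cong colour (node-rot (cross (β , f)))) (crossed f (T β) refl))
      where
      distinct : ∀ f → (β , f) ≢ (b , true) → (β , f) ≢ (b , false) → β ≢ b
      distinct true  ≢v ≢e eq = ≢v (cong (_, true) eq)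
      distinct false ≢v ≢e eq = ≢e (cong (_, false) eq)
      β≢b : β ≢ b
      β≢b = distinct f ≢v ≢e
      crossed : ∀ f x → T β ≡ x → colour (node (β , (if x then not f else f))) ≡ colour (node (β , f))
      crossed f     false _  = refl
      crossed true  true  tβ = sym (respects β tβ β≢b)
      crossed false true  tβ = respects β tβ β≢b

    colour-next-end : ∀ f → colour (node (next (b , f))) ≡ not f
    colour-next-end f = trans (cong (colour ∘ node) (next-edge b f t))
                              (trans (cong colour (node-rot (b , not f))) (colour-end (not f)))

  -- The tour visits every state

  Occ : State → Set
  Occ = Occurs ρ start T

  occ-iter : ∀ {s} j → Occ s → Occ (iter j next s)
  occ-iter j (k , refl) = j + k , iter-+ next j k start

  -- The step from `(b , f)` leads to the side `not f`. There `(b , f)` cannot recur, having colour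
  -- `f`, so by `colour-next` the side is left only from `(b , not f)`.
  colour-stays : ∀ {b} (t : T b ≡ true) f k → let open Colour t in
                 colour (node (iter k next (next (b , f)))) ≡ not f
                 ⊎ ∃[ j ] iter j next (next (b , f)) ≡ (b , not f)
  colour-stays t f zero = inj₁ (Colour.colour-next-end t f)
  colour-stays {b} t f (suc k) with colour-stays t f k
  ... | inj₂ found = inj₂ found
  ... | inj₁ eq with iter k next (next (b , f)) ≟S (b , not f)
  ...   | yes found = inj₂ (k , found)
  ...   | no ≢not = inj₁ (trans (uncurry (colour-next _) (sides f ≢f ≢not)) eq)
    where
    open Colour t
    ≢f : iter k next (next (b , f)) ≢ (b , f)
    ≢f eq′ = Bool.not-¬ (trans (cong (colour ∘ node) eq′) (colour-end f)) eq
    sides : ∀ {s} f → s ≢ (b , f) → s ≢ (b , not f) → s ≢ (b , true) × s ≢ (b , false)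
    sides true  p q = p , q
    sides false p q = q , p

  -- The tour is periodic and changes colour only at b, so it can return to (b , f) only through (b , not f).
  occ-other-end : ∀ b f → T b ≡ true → Occ (b , f) → Occ (b , not f)
  occ-other-end b f t occ
    with p , periodic ← iter-recurrent next next-injective state-code state-code-injective (b , f)
    with colour-stays t f p
  ... | inj₂ (j , eq) = subst Occ eq (occ-iter j (occ-iter 1 occ))
  ... | inj₁ eq = contradiction
    (trans (sym (colour-end f)) (trans (cong (colour ∘ node) (trans (sym periodic) (sym (iter-suc next p (b , f))))) eq))
    (Bool.not-¬ refl)
    where open Colour t

  -- At an edge of `T` the tour does not turn at once; it turns when it comes back along the edge
  -- from its other end.
  occ-rot : ∀ s → Occ s → Occ (rot s)
  occ-rot (b , f) occ with T b in t
  ... | true  = subst Occ (trans (next-edge b (not f) t) (cong (λ g → rot (b , g)) (Bool.not-involutive f)))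
                      (occ-iter 1 (occ-other-end b f t occ))
  ... | false = subst Occ (next-nonedge b f t) (occ-iter 1 occ)

  occ-node : ∀ s s′ → node s ≡ node s′ → Occ s → Occ s′
  occ-node (b , false) (b′ , false) eq occ with emer-≡ b b′ (sym (Sum.inj₂-injective eq))
  ... | inj₁ refl = occ
  ... | inj₂ refl = occ-rot (b , false) occ
  occ-node (b , true) (b′ , true) eq occ with k , refl ← σ-cyc b b′ (Sum.inj₁-injective eq) = around k
    where
    around : ∀ k → Occ (iter k σ b , true)
    around zero    = occ
    around (suc k) = occ-rot _ (around k)

  -- Induction along a path in `T`: `occ-other-end` passes to the far end of an edge and `occ-node`
  -- spreads to all states at that node.
  occ-reach : ∀ {z} → Reach T (node start) z → ∀ s → node s ≡ z → Occ s
  occ-reach here s eq = occ-node start s (sym eq) (0 , refl)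
  occ-reach (there b r (t , inj₁ (refl , refl))) s eq =
    occ-node (b , false) s (sym eq) (occ-other-end b true t (occ-reach r (b , true) refl))
  occ-reach (there b r (t , inj₂ (refl , refl))) s eq =
    occ-node (b , true) s (sym eq) (occ-other-end b false t (occ-reach r (b , false) refl))

  occ-all : ∀ s → Occ s
  occ-all s = occ-reach (proj₁ spanning (node start) (node s)) s refl

  -- Times of first visit

  abstract
    first : ∀ s → ∃[ l ] tour ρ start T l ≡ s × (∀ {j} → tour ρ start T j ≡ s → l ≤ j)
    first s = least (λ k → tour ρ start T k ≟S s) {proj₁ (occ-all s)} (proj₂ (occ-all s))

  -- The iterated tour runs on past its first return to `start`; taking the first visit gives the
  -- position of `s` in the first round and turns `Precedes` into `<` on ℕ.
  τ : State → ℕ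
  τ s = proj₁ (first s)

  tour-τ : ∀ s → tour ρ start T (τ s) ≡ s
  tour-τ s = proj₁ (proj₂ (first s))

  τ-least : ∀ {k s} → tour ρ start T k ≡ s → τ s ≤ k
  τ-least {s = s} = proj₂ (proj₂ (first s))

  τ-injective : ∀ {s s′} → τ s ≡ τ s′ → s ≡ s′
  τ-injective {s} {s′} eq = trans (sym (tour-τ s)) (trans (cong (tour ρ start T) eq) (tour-τ s′))

  precedes⇒< : ∀ {s s′} → Precedes ρ start T s s′ → τ s < τ s′
  precedes⇒< {s} {s′} ((k , eq , avoid) , _) =
    ℕ.≰⇒> (λ le → avoid (τ s′) (ℕ.≤-trans le (τ-least eq)) (tour-τ s′))

  <⇒precedes : ∀ {s s′} → τ s < τ s′ → Precedes ρ start T s s′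
  <⇒precedes {s} {s′} lt =
    (τ s , tour-τ s , λ j j≤ eq → ℕ.<⇒≱ lt (ℕ.≤-trans (τ-least eq) j≤)) , occ-all s′

  -- If the state at time `k` had been visited before, `s` would have been visited before time
  -- `suc k`.
  τ-pred : ∀ {s k} → τ s ≡ suc k → ∃[ s₀ ] next s₀ ≡ s × τ s₀ ≡ k
  τ-pred {s} {k} eq = s₀ , next-s₀ , ℕ.≤-antisym (τ-least refl)
    (s≤s⁻¹ (ℕ.≤-trans (ℕ.≤-reflexive (sym eq)) (τ-least (trans (cong next (tour-τ s₀)) next-s₀))))
    where
    s₀ = tour ρ start T k
    next-s₀ : next s₀ ≡ s
    next-s₀ = trans (cong (tour ρ start T) (sym eq)) (tour-τ s)

  -- From `s` the tour starts over, so every state already appears by time `τ s`.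
  τ-period : ∀ {s} → next s ≡ start → ∀ s′ → τ s′ ≤ τ s
  τ-period {s} wraps s′ = let j , j≤ , eq = early (τ s′) in ℕ.≤-trans (τ-least (trans eq (tour-τ s′))) j≤
    where
    early : ∀ k → ∃[ j ] j ≤ τ s × tour ρ start T j ≡ tour ρ start T k
    early zero = 0 , z≤n , refl
    early (suc k) with early k
    ... | j , j≤ , eq with j ℕ.≟ τ s
    ...   | no  j≢   = suc j , ℕ.≤∧≢⇒< j≤ j≢ , cong next eq
    ...   | yes refl = 0 , z≤n , trans (sym wraps) (cong next (trans (sym (tour-τ s)) eq))

  -- This could fail only at the last state of a round, whose successor is `start`; the later state
  -- `s′` excludes that case.
  τ-next : ∀ {s s′} → τ s < τ s′ → τ (next s) ≡ suc (τ s)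
  τ-next {s} {s′} lt with τ (next s) in eq
  ... | zero  = contradiction (τ-period (trans (sym (tour-τ (next s))) (cong (tour ρ start T) eq)) s′) (ℕ.<⇒≱ lt)
  ... | suc k with s₀ , next-s₀ , τs₀ ← τ-pred eq = cong suc (trans (sym τs₀) (cong τ (next-injective next-s₀)))

  -- Child half-edges and the interval of the true side

  IsChild : BEdge → Set
  IsChild b = T (flipE b) ≡ true × τ (flipE b , true) < τ (b , true)

  module Child {b} (t : T b ≡ true) (child : IsChild b) where
    open Colour t public
    private
      t′ = proj₁ child
      lt = proj₂ child
      X Y : State
      X = b , false
      Y = b , true

    -- The tour crosses `flipE b` to `emer b` and turns there to the only other half-edge, `b`.
    τX : τ (b , false) ≡ suc (τ (flipE b , true))
    τX = trans (cong τ (sym to-X)) (τ-next lt)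
      where
      to-X : next (flipE b , true) ≡ X
      to-X = trans (next-edge (flipE b) true t′) (cong (_, false) (flipE-involutive b))

    X<Y : τ X < τ Y
    X<Y = ℕ.≤∧≢⇒< (subst (_≤ τ Y) (sym τX) lt) (λ eq → case cong proj₂ (τ-injective eq) of λ ())

    -- The colour is constant up to time `τ X`, because neither state at `b` has been visited
    -- before.
    start-false : colour (node start) ≡ false
    start-false = trans (sym (constant (τ X) ℕ.≤-refl)) (trans (cong (colour ∘ node) (tour-τ X)) emer-false)
      where
      constant : ∀ k → k ≤ τ X → colour (node (tour ρ start T k)) ≡ colour (node start)
      constant zero    _    = refl
      constant (suc k) k<τX = trans
        (colour-next _ (λ eq → ℕ.<⇒≱ (ℕ.<-trans k<τX X<Y) (τ-least eq)) (λ eq → ℕ.<⇒≱ k<τX (τ-least eq)))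
        (constant k (ℕ.<⇒≤ k<τX))

    -- Open on the left since `(b , false)` is still at `emer b`, closed on the right since
    -- `(b , true)` is still at `vert b`.
    In : ℕ → Set
    In k = τ X < k × k ≤ τ Y

    -- Induction on time from the false base: the colour changes exactly on leaving `X` and on
    -- leaving `Y`, which is also when the interval is entered and left.
    interval : ∀ k s → τ s ≡ k → (colour (node s) ≡ true × In k) ⊎ (colour (node s) ≡ false × ¬ In k)
    interval zero s eq = inj₂
      (trans (cong (colour ∘ node) (trans (sym (tour-τ s)) (cong (tour ρ start T) eq))) start-false , λ ())
    interval (suc k) s eq with s₀ , refl , τs₀ ← τ-pred eq | s₀ ≟S X | s₀ ≟S Y
    ... | yes refl | _ = inj₁ (colour-next-end false , s≤s (ℕ.≤-reflexive τs₀) , subst (_< τ Y) τs₀ X<Y)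
    ... | no _ | yes refl = inj₂ (colour-next-end true , λ (_ , le) → ℕ.<-irrefl (sym τs₀) le)
    ... | no ≢X | no ≢Y with interval k s₀ τs₀
    ...   | inj₁ (p , lo , hi) =
      inj₁ (trans (colour-next s₀ ≢Y ≢X) p , ℕ.m<n⇒m<1+n lo ,
            ℕ.≤∧≢⇒< hi (λ k≡ → ≢Y (τ-injective (trans τs₀ k≡))))
    ...   | inj₂ (p , ¬in) =
      inj₂ (trans (colour-next s₀ ≢Y ≢X) p ,
            λ (lo , hi) → ¬in (ℕ.≤∧≢⇒< (s≤s⁻¹ lo) (λ ≡k → ≢X (τ-injective (trans τs₀ (sym ≡k)))) , ℕ.<⇒≤ hi))

    true⇒in : ∀ s → colour (node s) ≡ true → In (τ s)
    true⇒in s p with interval (τ s) s refl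
    ... | inj₁ (_ , i) = i
    ... | inj₂ (q , _) = case trans (sym p) q of λ ()

    false⇒out : ∀ s → colour (node s) ≡ false → ¬ In (τ s)
    false⇒out s p with interval (τ s) s refl
    ... | inj₁ (q , _) = case trans (sym p) q of λ ()
    ... | inj₂ (_ , o) = o

    flip-false : colour (inj₁ (vert (flipE b))) ≡ false
    flip-false = trans (respects (flipE b) t′ (flipE-≢ b)) emer-false

  -- Pivots, the half-edges that match inactive elements

  Pivot : BEdge → Set
  Pivot b = Σ (T b ≡ true) λ t → IsChild b × ∃ (Colour.Crossing t)

  Pivot? : ∀ b → Dec (Pivot b)
  Pivot? b with T b Bool.≟ true
  ... | no ¬t = no (¬t ∘ proj₁)
  -- The cut, and with it `Crossing`, depends on the proof `t`; uniqueness of equality proofs on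
  -- `Bool` carries the decision over to every other proof.
  ... | yes t = map′ (t ,_)
    (λ (t₁ , q) → subst (λ t → IsChild b × ∃ (Colour.Crossing t)) (≡-irrelevant t₁ t) q)
    (((T (flipE b) Bool.≟ true) ×-dec (τ (flipE b , true) ℕ.<? τ (b , true)))
     ×-dec anyB? (λ b′ → (colour (inj₂ (emer b′)) Bool.≟ true) ×-dec (colour (inj₁ (vert b′)) Bool.≟ false)))
    where
    open Colour t
    open Decidable⇒UIP Bool._≟_ using (≡-irrelevant)

  -- Of the two half-edges at an emerald node, only the one with the later violet state can be a
  -- child.
  pivot-emer : ∀ {b b′} → Pivot b → Pivot b′ → emer b ≡ emer b′ → b ≡ b′
  pivot-emer {b} {b′} (_ , (_ , lt) , _) (_ , (_ , lt′) , _) eq with emer-≡ b′ b eq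
  ... | inj₁ b≡b′ = b≡b′
  ... | inj₂ refl = contradiction (subst (λ β → τ (β , true) < τ (flipE b′ , true)) (flipE-involutive b′) lt) (ℕ.<⇒≯ lt′)

  -- The edge `b′` of `T` puts `emer b′` on the true side of `b`, all of whose states come after
  -- `(b , false)`. By symmetry, distinct pivots cannot share a violet node.
  parent-later : ∀ {b b′} → Pivot b → Pivot b′ → vert b ≡ vert b′ → b′ ≢ b → τ (b , false) < τ (b′ , false)
  parent-later {b} {b′} (t , child , _) (t′ , _) eq b′≢b = proj₁ (true⇒in (b′ , false)
    (trans (sym (respects b′ t′ b′≢b)) (trans (cong (colour ∘ inj₁) (sym eq)) vert-true)))
    where open Child t child

  pivot-vert : ∀ {b b′} → Pivot b → Pivot b′ → vert b ≡ vert b′ → b ≡ b′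
  pivot-vert {b} {b′} p p′ eq with b ≟B b′
  ... | yes b≡b′ = b≡b′
  ... | no  b≢b′ = contradiction (parent-later p p′ eq (b≢b′ ∘ sym)) (ℕ.<⇒≯ (parent-later p′ p (sym eq) b≢b′))

  degE-split : ∀ S b → degE S (emer b) ≡ ⟦ S b ⟧ + ⟦ S (flipE b) ⟧
  degE-split S (e , false) = refl
  degE-split S (e , true)  = ℕ.+-comm ⟦ S (e , false) ⟧ _

  degE-both : ∀ b → T b ≡ true → T (flipE b) ≡ true → degE T (emer b) ≡ 2
  degE-both b t t′ = trans (degE-split T b) (cong₂ _+_ (cong ⟦_⟧ t) (cong ⟦_⟧ t′))

  -- From a crossing edge to inactivity

  module VCut (jaeger : IsVCutJaeger ρ start T) where

    violet-first : ∀ {b} → T b ≡ false → τ (b , true) < τ (b , false)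
    violet-first t = precedes⇒< (jaeger _ t)

    module _ {b} (t : T b ≡ true) (child : IsChild b) {b′} (crossing : Colour.Crossing t b′) where
      open Child t child
      open Exchange spanning t (cut spanning b t) (proj₁ crossing) (proj₂ crossing) hiding (connected)

      -- Of the two states of `b′`, the emerald one lies in the interval and the violet one outside.
      -- The violet one comes first since `b′` is cut there, so it precedes the whole interval.
      crossing-before : τ (b′ , true) < τ (b , false)
      crossing-before = ℕ.≤∧≢⇒<
        (ℕ.≮⇒≥ λ lo → false⇒out (b′ , true) (proj₂ crossing)
          (lo , ℕ.≤-trans (ℕ.<⇒≤ (violet-first b′∉T)) (proj₂ (true⇒in (b′ , false) (proj₁ crossing)))))
        (λ eq → case cong proj₂ (τ-injective eq) of λ ())

      inactiveE : InternallyInactive IsHypertreeE (VioletOrderE ρ start T) (fE T) (emer b)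
      inactiveE = emer b′ , (proj₂ b′ , λ s → <⇒precedes (before (emer b , s) refl)) , 1≤fE , hypertreeE
        where
        1≤fE : 1 ≤ fE T (emer b)
        1≤fE = ℕ.≤-reflexive (cong (_∸ 1) (sym (degE-both b t (proj₁ child))))
        before : ∀ β → emer β ≡ emer b → τ (b′ , true) < τ (β , true)
        before β eq with emer-≡ b β eq
        ... | inj₁ refl = ℕ.<-trans crossing-before X<Y
        -- The state `(flipE b , true)` immediately precedes `(b , false)`; it is not `(b′ , true)`,
        -- because `flipE b` is in `T` and `b′` is not.
        ... | inj₂ refl = ℕ.≤∧≢⇒< (s≤s⁻¹ (subst (τ (b′ , true) <_) τX crossing-before))
          (λ eq → case trans (sym (proj₁ child)) (trans (cong (T ∘ proj₁) (sym (τ-injective eq))) b′∉T) of λ ())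

      inactiveV : InternallyInactive IsHypertreeV (VioletOrderV ρ start T) (fV T) (vert b)
      inactiveV = vert b′ ,
        (b′ , refl , λ β eq → <⇒precedes (ℕ.<-trans crossing-before
          (proj₁ (true⇒in (β , true) (trans (cong (colour ∘ inj₁) eq) vert-true))))) ,
        fV-pos , hypertreeV

    -- From inactivity to a crossing edge

    module _ {b} (t : T b ≡ true) (child : IsChild b) where
      open Child t child

      -- In `T′` only emerald nodes of degree 2 connect violet nodes. Apart from `e′` these have
      -- degree 2 in `T` as well and differ from `emer b`, so their ends agree in colour; then `e′`
      -- has to link the two sides.
      transferE-bichromatic : ∀ {e′} → IsHypertreeE (transfer (fE T) (emer b) e′) →
                              colour (inj₁ (end e′ false)) ≢ colour (inj₁ (end e′ true))
      transferE-bichromatic {e′} (T′ , (connected′ , _) , deg′) same =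
        case trans (sym vert-true) (trans (reach-colour c closed (connected′ (inj₁ (vert b)) (inj₁ (vert (flipE b))))) flip-false) of λ ()
        where
        c : Node → Bool
        c (inj₁ v) = colour (inj₁ v)
        -- Emerald nodes are recoloured by an edge of `T′`, since their colours in the cut follow
        -- the edges of `T`.
        c (inj₂ ε) = if T′ (ε , false) then colour (inj₁ (end ε false)) else colour (inj₁ (end ε true))
        both : ∀ S ε → degE S ε ≡ 2 → S (ε , false) ≡ true × S (ε , true) ≡ true
        both S ε eq with S (ε , false) | S (ε , true)
        ... | true  | true  = refl , refl
        ... | true  | false = case eq of λ ()
        ... | false | true  = case eq of λ ()
        ... | false | false = case eq of λ ()
        monochromatic : ∀ ε → degE T′ ε ≡ 2 → colour (inj₁ (end ε false)) ≡ colour (inj₁ (end ε true))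
        monochromatic ε two with ε ≟ emer b | ε ≟ e′ | trans (sym (deg′ ε)) two
        ... | yes refl | _ | eq = case trans (cong (λ d → suc (d ∸ 1 ∸ 1)) (sym (degE-both b t (proj₁ child)))) eq of λ ()
        ... | no _ | yes refl | _ = same
        ... | no ε≢ | no _ | eq with both T ε (trans (sym (ℕ.m+[n∸m]≡n (degE-pos (proj₁ spanning) ε))) eq)
        ...   | tf , tt = trans (respects (ε , false) tf (ε≢ ∘ cong proj₁))
                               (sym (respects (ε , true) tt (ε≢ ∘ cong proj₁)))
        closed : Closed T′ c
        closed (ε , false) tf rewrite tf = refl
        closed (ε , true)  tt with T′ (ε , false) in tf
        ... | false = refl
        ... | true  = sym (monochromatic ε (cong₂ _+_ (cong ⟦_⟧ tf) (cong ⟦_⟧ tt)))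

      -- Were emer b₁ attached to the false side, b₁ would be cut at its emerald end: the tour reaches
      -- emer b₁ before it enters the true side, which contains vert b₁.
      earlier-attached : ∀ b₁ → emer b₁ ≢ emer b → (∃[ u ] τ ((emer b₁ , u) , true) < τ (flipE b , true)) →
                         colour (inj₁ (vert b₁)) ≡ true → colour (inj₂ (emer b₁)) ≡ true
      earlier-attached b₁ e₁≢e (u , before) v₁ = Bool.¬-not λ e₁ →
        let t₁ : T b₁ ≡ false
            t₁ = not-true λ t₁ → case trans (sym v₁) (trans (respects b₁ t₁ (e₁≢e ∘ cong emer)) e₁) of λ ()
        in impossible t₁ (emer-≡ b₁ (emer b₁ , u) refl)
        where
        after : τ (flipE b , true) < τ (b₁ , true)
        after = ℕ.<-trans (subst (τ (flipE b , true) <_) (sym τX) ℕ.≤-refl) (proj₁ (true⇒in (b₁ , true) v₁))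
        impossible : T b₁ ≡ false → ¬ ((emer b₁ , u) ≡ b₁ ⊎ (emer b₁ , u) ≡ flipE b₁)
        impossible t₁ (inj₁ eq) = ℕ.<⇒≯ after (subst (λ β → τ (β , true) < τ (flipE b , true)) eq before)
        impossible t₁ (inj₂ eq) with T (flipE b₁) in t₂
        -- The tour goes directly from `(flipE b₁ , true)` to `(b₁ , false)`, so the latter is no
        -- later than `(flipE b , true)` and hence before `(b₁ , true)`, although `b₁` is cut at its
        -- violet end.
        ... | true = ℕ.<⇒≱ (ℕ.<-trans after (violet-first t₁)) (subst (_≤ τ (flipE b , true)) τ-emer before₂)
          where
          before₂ : τ (flipE b₁ , true) < τ (flipE b , true)
          before₂ = subst (λ β → τ (β , true) < τ (flipE b , true)) eq before
          τ-emer : suc (τ (flipE b₁ , true)) ≡ τ (b₁ , false)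
          τ-emer = trans (sym (τ-next before₂))
            (cong τ (trans (next-edge (flipE b₁) true t₂) (cong (_, false) (flipE-involutive b₁))))
        -- With both half-edges missing from `T`, `emer b₁` would be isolated.
        ... | false = case subst (1 ≤_) (trans (degE-split T b₁) (cong₂ _+_ (cong ⟦_⟧ t₁) (cong ⟦_⟧ t₂)))
                                 (degE-pos (proj₁ spanning) (emer b₁)) of λ ()

      -- The ends of `e′` differ in colour, and its true end forces `e′` itself onto the true side;
      -- so the half-edge to its false end crosses.
      crossingE : ∀ {e′} → VioletOrderE ρ start T e′ (emer b) →
                  IsHypertreeE (transfer (fE T) (emer b) e′) → ∃ Crossing
      crossingE {e′} (u , precedes) hyper =
        pick (colour (inj₁ (end e′ false))) (colour (inj₁ (end e′ true))) refl refl
        where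
        e′≢e : e′ ≢ emer b
        e′≢e refl = ℕ.<-irrefl refl (precedes⇒< (precedes u))
        attached : ∀ s → colour (inj₁ (end e′ s)) ≡ true → colour (inj₂ e′) ≡ true
        -- The order is evaluated at `flipE b`, the earlier of the two half-edges at `emer b`.
        attached s = earlier-attached (e′ , s) e′≢e (u , precedes⇒< (precedes (proj₂ (flipE b))))
        pick : ∀ p q → colour (inj₁ (end e′ false)) ≡ p → colour (inj₁ (end e′ true)) ≡ q → ∃ Crossing
        pick true  false pf pt = (e′ , true)  , attached false pf , pt
        pick false true  pf pt = (e′ , false) , attached true pt , pf
        pick true  true  pf pt = contradiction (trans pf (sym pt)) (transferE-bichromatic hyper)
        pick false false pf pt = contradiction (trans pf (sym pt)) (transferE-bichromatic hyper)

      -- The state `(σ b , true)` at `vert b` directly follows `(b , false)`, so whatever precedes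
      -- it is no later than `(b , false)`, before the true interval. Thus `v′` is false and
      -- `crossing-edge` applies.
      crossingV : ∀ {v′} → VioletOrderV ρ start T v′ (vert b) → 1 ≤ fV T (vert b) →
                  IsHypertreeV (transfer (fV T) (vert b) v′) → ∃ Crossing
      crossingV {v′} (β , refl , precedes) = crossing-edge spanning t (cut spanning b t) (not-true λ vβ →
        ℕ.<⇒≱ (subst (τ (β , true) <_) τσ (precedes⇒< (precedes (σ b) (σ-vert b)))) (proj₁ (true⇒in (β , true) vβ)))
        where
        τσ : τ (σ b , true) ≡ suc (τ (b , false))
        τσ = trans (cong τ (sym (next-edge b false t))) (τ-next X<Y)

    -- Every inactive element is an end of a pivot

    -- Positivity of `fE` puts both half-edges at `e` into `T`, and the one with the later violet
    -- state is the child.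
    pivotE : ∀ {e} → InternallyInactive IsHypertreeE (VioletOrderE ρ start T) (fE T) e → ∃[ s ] Pivot (e , s)
    pivotE {e} (e′ , order , 1≤fE , hyper) = choose (T (e , false)) (T (e , true)) refl refl 1≤fE
      where
      choose : ∀ p q → T (e , false) ≡ p → T (e , true) ≡ q → 1 ≤ ⟦ p ⟧ + ⟦ q ⟧ ∸ 1 → ∃[ s ] Pivot (e , s)
      choose true  false _ _ ()
      choose false true  _ _ ()
      choose false false _ _ ()
      choose true  true  tf tt _ with ℕ.<-cmp (τ ((e , false) , true)) (τ ((e , true) , true))
      ... | tri< lt _ _ = true  , tt , (tf , lt) , crossingE tt (tf , lt) order hyper
      ... | tri> _ _ gt = false , tf , (tt , gt) , crossingE tf (tt , gt) order hyper
      ... | tri≈ _ eq _ = case cong (proj₂ ∘ proj₁) (τ-injective eq) of λ ()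

    cross-edge : ∀ b f → T b ≡ true → cross (b , f) ≡ (b , not f)
    cross-edge b f t = cong (λ x → b , (if x then not f else f)) t

    cross-nonedge : ∀ b f → T b ≡ false → cross (b , f) ≡ (b , f)
    cross-nonedge b f t = cong (λ x → b , (if x then not f else f)) t

    cross-pred : ∀ {s s′} → next s ≡ rot s′ → s ≡ cross s′
    cross-pred {s} {s′} eq = trans (sym (cross-involutive s))
                                   (cong cross (rot-injective (trans (sym (next≡rot∘cross s)) eq)))

    -- Going back from the first visit to v, the tour passes (b , false) and then either (flipE b , true)
    -- or, if flipE b ∉ T, (flipE b , false) preceded by (b , true), which is still at v.
    parent : ∀ {v β} → (∀ b → vert b ≡ v → τ (β , true) < τ (b , true)) →
             ∃[ b ] vert b ≡ v × T b ≡ true × IsChild b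
    parent {v} {β} before
      with proj₁ spanning (inj₂ (emer β)) (inj₁ v)
    ... | there b _ (_ , inj₂ (_ , refl))
      with least (λ k → node (tour ρ start T k) ≟N inj₁ v) {τ (b , true)} (cong node (tour-τ (b , true)))
    ... | l , at-v , l-least = arrive _ refl at-v
      where
      l≤ : ∀ {s} → node s ≡ inj₁ v → l ≤ τ s
      l≤ {s} eq = l-least (trans (cong node (tour-τ s)) eq)
      enter : ∀ b k → vert b ≡ v → T b ≡ true → τ (b , false) ≡ k → suc k ≤ l → τ (β , true) < k →
              ∃[ b ] vert b ≡ v × T b ≡ true × IsChild b
      -- `k` is positive because `(β , true)` comes earlier, so `(b , false)` has a predecessor in
      -- the tour.
      enter b (suc k) bv t τk k<l β<k with s₁ , to-b , τs₁ ← τ-pred τk | T (flipE b) in t′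
      ... | true = b , bv , t , t′ , (begin-strict
        τ (flipE b , true) ≡⟨ cong τ (sym s₁≡) ⟩
        τ s₁               ≡⟨ τs₁ ⟩
        k                  <⟨ ℕ.≤-trans (ℕ.n≤1+n _) k<l ⟩
        l                  ≤⟨ l≤ (cong inj₁ bv) ⟩
        τ (b , true)       ∎)
        where
        open ℕ.≤-Reasoning
        s₁≡ : s₁ ≡ (flipE b , true)
        s₁≡ = trans (cross-pred (trans to-b (cong (_, false) (sym (flipE-involutive b))))) (cross-edge _ false t′)
      ... | false = contradiction (l≤ {b , true} (cong inj₁ bv)) (ℕ.<⇒≱ (back k τ-flip (violet-first t′)))
        where
        τ-flip : τ (flipE b , false) ≡ k
        τ-flip = trans (cong τ (sym (trans
          (cross-pred (trans to-b (cong (_, false) (sym (flipE-involutive b))))) (cross-nonedge _ false t′)))) τs₁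
        back : ∀ k′ → τ (flipE b , false) ≡ k′ → τ (flipE b , true) < τ (flipE b , false) → τ (b , true) < l
        back zero    eq lt = contradiction (subst (τ (flipE b , true) <_) eq lt) λ ()
        back (suc k′) eq lt with s₂ , to-flip , τs₂ ← τ-pred eq = begin-strict
          τ (b , true) ≡⟨ cong τ (trans (sym (cross-edge b false t)) (sym (cross-pred to-flip))) ⟩
          τ s₂         ≡⟨ τs₂ ⟩
          k′           <⟨ ℕ.n<1+n k′ ⟩
          suc k′       ≡⟨ trans (sym eq) τ-flip ⟩
          k            ≤⟨ ℕ.≤-trans (ℕ.m≤n+m k 2) k<l ⟩
          l            ∎
          where open ℕ.≤-Reasoning
      leave : ∀ k → suc k ≤ l → ∀ s₀ → τ s₀ ≡ k → node (cross s₀) ≡ inj₁ v → τ (β , true) < suc k →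
              ∃[ b ] vert b ≡ v × T b ≡ true × IsChild b
      leave k k<l (b , f) τs₀ eq β≤k with T b in t | f
      -- Turning at `v` itself would mean an earlier visit to `v`.
      ... | false | true  = contradiction (ℕ.≤-trans (l≤ {b , true} eq) (ℕ.≤-reflexive τs₀)) (ℕ.<⇒≱ k<l)
      ... | true  | false = enter b k (Sum.inj₁-injective eq) t τs₀ k<l
        (ℕ.≤∧≢⇒< (s≤s⁻¹ β≤k) (λ β≡k → case cong proj₂ (τ-injective (trans β≡k (sym τs₀))) of λ ()))
      ... | false | false = case eq of λ ()
      ... | true  | true  = case eq of λ ()
      arrive : ∀ s → s ≡ tour ρ start T l → node s ≡ inj₁ v → ∃[ b ] vert b ≡ v × T b ≡ true × IsChild b
      arrive (b , true) s≡ eq with τ (b , true) in τs | ℕ.≤-antisym (τ-least (sym s≡)) (l≤ {b , true} eq) | before b (Sum.inj₁-injective eq)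
      -- The tour does not begin at `v`, because `(β , true)` is visited before every violet state
      -- there.
      ... | zero  | _    | lt = contradiction lt λ ()
      ... | suc k | refl | lt with s₀ , to-s , τs₀ ← τ-pred τs =
        leave k ℕ.≤-refl s₀ τs₀
          (trans (sym (node-rot (cross s₀))) (trans (cong node (trans (sym (next≡rot∘cross s₀)) to-s)) eq))
          lt

    pivotV : ∀ {v} → InternallyInactive IsHypertreeV (VioletOrderV ρ start T) (fV T) v → ∃[ b ] vert b ≡ v × Pivot b
    pivotV (v′ , order@(β , _ , precedes) , 1≤fV , hyper)
      with b , refl , t , child ← parent (λ b eq → precedes⇒< (precedes b eq))
      = b , refl , t , child , crossingV t child order 1≤fV hyper

-- Equality of the two counts through pivots

theorem8p1 : (n m : ℕ) (end : Fin m → Bool → Fin n) → Bip.Loopless end →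
    (ρ : Bip.Ribbon end) (start : Bip.State end) (T : Bip.Sub end) →
    Bip.IsSpanningTree end T → Bip.IsVCutJaeger end ρ start T →
    ∃[ k ] NumberIs (InternallyInactive (Bip.IsHypertreeE end) (Bip.VioletOrderE end ρ start T) (Bip.fE end T)) k
    × NumberIs (InternallyInactive (Bip.IsHypertreeV end) (Bip.VioletOrderV end ρ start T) (Bip.fV end T)) k
theorem8p1 n m end _ ρ start T spanning jaeger =
  NumberIs-correspondence {R = R} R?
    (λ e → mk⇔ (λ i → let s , p = pivotE i in vert (e , s) , s , refl , p) (λ (_ , _ , _ , t , child , _ , crossing) → inactiveE t child crossing))
    (λ v → mk⇔ (λ i → let (e , s) , eq , p = pivotV i in e , s , eq , p) λ { (_ , _ , refl , t , child , _ , crossing) → inactiveV t child crossing })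
    (λ { (_ , refl , p) (_ , refl , p′) → cong vert (pivot-emer p p′ refl) })
    (λ { (_ , refl , p) (_ , eq , p′) → cong emer (pivot-vert p p′ (sym eq)) })
  where
  open Bip end
  open Tour ρ start T spanning
  open VCut jaeger
  R : Fin m → Fin n → Set
  R e v = ∃[ s ] vert (e , s) ≡ v × Pivot (e , s)
  R? : ∀ e v → Dec (R e v)
  R? e v = map′ (λ { (inj₁ r) → false , r ; (inj₂ r) → true , r })
                (λ { (false , r) → inj₁ r ; (true , r) → inj₂ r })
                (side false ⊎-dec side true)
    where
    side : ∀ s → Dec (vert (e , s) ≡ v × Pivot (e , s))
    side s = (vert (e , s) ≟ v) ×-dec Pivot? (e , s)
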